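{- Let $\mathbf{k}$ be a commutative ring, $q\in\mathbf{k}$, and let $a,b\in\mathbf{k}$ with $a+b=q-1$. Let $\lambda=(\lambda_1,\lambda_2,\dots)$ and $\mu=(\mu_1,\mu_2,\dots)$ be partitions, and set $\ell_i:=\lambda_i-i$ and $m_i:=\mu_i-i$ for each $i\ge 1$. Then \[ \nabla_q\left(s_{\lambda/\mu}\right)=\sum_{\substack{i\ge 1;\\ \lambda-e_i\text{ is a partition}}}(\ell_i+a)\,s_{(\lambda-e_i)/\mu}+\sum_{\substack{i\ge 1;\\ \mu+e_i\text{ is a partition}}}(b-m_i)\,s_{\lambda/(\mu+e_i)}. \]
   Context: $\Lambda$ is the ring of symmetric functions in infinitely many variables $x_1,x_2,\dots$ over $\mathbf{k}$; $h_n\in\Lambda$ is the $n$-th complete homogeneous symmetric function ($h_0=1$, $h_n=0$ for $n<0$). $\nabla_q:\Lambda\to\Lambda$ is the unique $\mathbf{k}$-linear derivation satisfying $\nabla_q(h_n)=(n+q-1)h_{n-1}$ for each $n>0$ (well defined since $h_1,h_2,\dots$ freely generate $\Lambda$ as a commutative $\mathbf{k}$-algebra). A partition is a weakly decreasing sequence of nonnegative integers with finitely many nonzero entries; $e_i$ is the sequence $(0,\dots,0,1,0,\dots)$ with $1$ in position $i$, and sequences are added/subtracted entrywise. $s_{\lambda/\mu}\in\Lambda$ is the skew Schur function (zero unless $\mu_i\le\lambda_i$ for all $i$). -}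

module Defs where

open import Level using (_⊔_)
open import Algebra.Bundles using (CommutativeRing)
open import Data.Nat using (ℕ; zero; suc; _∸_; _≤ᵇ_; _<ᵇ_; _≡ᵇ_; pred)
open import Data.Bool using (Bool; true; false; _∧_; if_then_else_)
open import Data.List using (List; []; _∷_; [_]; _++_; map; foldr; length; upTo; concatMap; zipWith; filter)
open import Data.Bool.ListAction using (and; all)
open import Data.Nat.ListAction using (sum)
open import Relation.Binary.PropositionalEquality using (_≡_)
open import Relation.Unary using (Pred)
open import Data.List.Relation.Unary.Linked using (Linked)
open import Data.Nat using (_≥_)

-- Combinatorics on ℕ-lists (sequences with implicit trailing zeros)

lookupD : List ℕ → ℕ → ℕ
lookupD []       _       = 0
lookupD (x ∷ xs) zero    = x
lookupD (x ∷ xs) (suc k) = lookupD xs k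

-- A partition: a weakly decreasing list of naturals (trailing zeros allowed)
IsPartition : List ℕ → Set
IsPartition = Linked _≥_

isPartitionᵇ : List ℕ → Bool
isPartitionᵇ []           = true
isPartitionᵇ (x ∷ [])     = true
isPartitionᵇ (x ∷ y ∷ xs) = (y ≤ᵇ x) ∧ isPartitionᵇ (y ∷ xs)

-- subtract / add 1 at (0-based) position k ;  decAt λ k = λ - e_{k+1}
decAt : List ℕ → ℕ → List ℕ
decAt []       _       = []
decAt (x ∷ xs) zero    = pred x ∷ xs
decAt (x ∷ xs) (suc k) = x ∷ decAt xs k

incAt : List ℕ → ℕ → List ℕ
incAt []       zero    = 1 ∷ []
incAt []       (suc k) = 0 ∷ incAt [] k
incAt (x ∷ xs) zero    = suc x ∷ xs
incAt (x ∷ xs) (suc k) = x ∷ incAt xs k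

-- λ - e_{k+1} is a partition (entry must be ≥ 1 to stay nonnegative)
minusIsPart : List ℕ → ℕ → Bool
minusIsPart la k = (1 ≤ᵇ lookupD la k) ∧ isPartitionᵇ (decAt la k)

plusIsPart : List ℕ → ℕ → Bool
plusIsPart mu k = isPartitionᵇ (incAt mu k)

below : List ℕ → List (List ℕ)
below []       = [] ∷ []
below (x ∷ xs) = concatMap (λ y → map (y ∷_) (below xs)) (upTo (suc x))

swapAt : ℕ → List ℕ → List ℕ
swapAt zero    []           = []
swapAt zero    (x ∷ [])     = 0 ∷ x ∷ []
swapAt zero    (x ∷ y ∷ xs) = y ∷ x ∷ xs
swapAt (suc k) []           = 0 ∷ swapAt k []
swapAt (suc k) (x ∷ xs)     = x ∷ swapAt k xs

allLists : ℕ → ℕ → List (List ℕ)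
allLists N zero      = [] ∷ []
allLists N (suc len) = concatMap (λ x → map (x ∷_) (allLists N len)) (map suc (upTo N))

fillings : ℕ → List ℕ → List (List (List ℕ))
fillings N []         = [] ∷ []
fillings N (r ∷ rows) = concatMap (λ row → map (row ∷_) (fillings N rows)) (allLists N r)

rowWeak : List ℕ → Bool
rowWeak []           = true
rowWeak (x ∷ [])     = true
rowWeak (x ∷ y ∷ xs) = (x ≤ᵇ y) ∧ rowWeak (y ∷ xs)

-- rows of λ/μ : row r occupies columns μ_r ,…, λ_r - 1 (0-based)
rowLengths : List ℕ → List ℕ → List ℕ
rowLengths la mu = map (λ r → lookupD la r ∸ lookupD mu r) (upTo (length la))

colPair : ℕ → ℕ → ℕ → List ℕ → List ℕ → Bool
colPair muUp laUp muLo up lo =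
  and (map (λ j → let c = muLo Data.Nat.+ j in
                  if (muUp ≤ᵇ c) ∧ (c <ᵇ laUp)
                  then lookupD up (c ∸ muUp) <ᵇ lookupD lo j
                  else true)
           (upTo (length lo)))

colStrict : List ℕ → List ℕ → ℕ → List (List ℕ) → Bool
colStrict la mu r []               = true
colStrict la mu r (x ∷ [])         = true
colStrict la mu r (up ∷ lo ∷ rows) =
  colPair (lookupD mu r) (lookupD la r) (lookupD mu (suc r)) up lo
  ∧ colStrict la mu (suc r) (lo ∷ rows)

countOcc : ℕ → List ℕ → ℕ
countOcc v xs = length (filter (λ x → x Data.Nat.≟ v) xs)

hasContent : List ℕ → List (List ℕ) → Bool
hasContent α T = and (map (λ j → countOcc (suc j) (Data.List.concat T) ≡ᵇ lookupD α j)
                          (upTo (length α)))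

isSSYT : List ℕ → List ℕ → List ℕ → List (List ℕ) → Bool
isSSYT la mu α T = all rowWeak T ∧ colStrict la mu 0 T ∧ hasContent α T

containedᵇ : List ℕ → List ℕ → Bool
containedᵇ la mu = and (map (λ r → lookupD mu r ≤ᵇ lookupD la r) (upTo (length mu)))

numSSYT : List ℕ → List ℕ → List ℕ → ℕ
numSSYT la mu α =
  length (filter (λ T → Relation.Nullary.Decidable.Core.T? (isSSYT la mu α T))
                 (fillings (length α) (rowLengths la mu)))
  where import Relation.Nullary.Decidable.Core

-- Symmetric functions over a commutative ring, as formal power series
-- in x₁,x₂,… : a series assigns a coefficient to each monomial
-- x^α (α a finite exponent list, trailing zeros implicit).

module SymFun {c ℓ} (R : CommutativeRing c ℓ) where
  open CommutativeRing R public

  Series : Set c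
  Series = List ℕ → Carrier

  _≋_ : Series → Series → Set ℓ
  f ≋ g = ∀ α → f α ≈ g α

  natR : ℕ → Carrier
  natR zero    = 0#
  natR (suc n) = 1# + natR n

  sumR : List Carrier → Carrier
  sumR = foldr _+_ 0#

  zeroS : Series
  zeroS _ = 0#

  _⊕_ : Series → Series → Series
  (f ⊕ g) α = f α + g α

  _·_ : Carrier → Series → Series
  (r · f) α = r * f α

  _⊛_ : Series → Series → Series
  (f ⊛ g) α = sumR (map (λ β → f β * g (zipWith _∸_ α β)) (below α))

  record IsΛ (f : Series) : Set (c ⊔ ℓ) where
    field
      padInv  : ∀ α → f (α ++ [ 0 ]) ≈ f α
      swapInv : ∀ k α → f (swapAt k α) ≈ f α
      deg     : ℕ
      bounded : ∀ α → (deg <ᵇ sum α) ≡ true → f α ≈ 0#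

  h : ℕ → Series
  h n α = if sum α ≡ᵇ n then 1# else 0#

  skewSchur : List ℕ → List ℕ → Series
  skewSchur la mu α = if containedᵇ la mu then natR (numSSYT la mu α) else 0#

  record IsNabla (q : Carrier) (D : Series → Series) : Set (c ⊔ ℓ) where
    field
      cong    : ∀ f g → IsΛ f → IsΛ g → f ≋ g → D f ≋ D g
      additive : ∀ f g → IsΛ f → IsΛ g → D (f ⊕ g) ≋ (D f ⊕ D g)
      homog   : ∀ r f → IsΛ f → D (r · f) ≋ (r · D f)
      leibniz : ∀ f g → IsΛ f → IsΛ g → D (f ⊛ g) ≋ ((D f ⊛ g) ⊕ (f ⊛ D g))
      onH     : ∀ n → D (h (suc n)) ≋ ((natR (suc n) + q + - 1#) · h n)

  sumS : List Series → Series
  sumS = foldr _⊕_ zeroS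

  -- right-hand side of the theorem; index i = k+1, k < K where
  -- K = length λ + length μ + 1 (all terms with i > K have false condition)
  rhs : Carrier → Carrier → List ℕ → List ℕ → Series
  rhs a b la mu =
    sumS (map (λ k → if minusIsPart la k
                     then ((natR (lookupD la k) + - natR (suc k)) + a) · skewSchur (decAt la k) mu
                     else zeroS) (upTo K))
    ⊕ sumS (map (λ k → if plusIsPart mu k
                       then (b + - (natR (lookupD mu k) + - natR (suc k))) · skewSchur la (incAt mu k)
                       else zeroS) (upTo K))
    where K = suc (length la Data.Nat.+ length mu)

{-# OPTIONS --safe #-}
module Submission where

-- The skew Schur function is the Jacobi–Trudi determinant J(ℓ , m) = det (h_{ℓᵢ - mⱼ}).  Both sides have the same
-- expansion in the first variable: removing the smallest letter of a tableau turns λ/μ into λ/ν with ν/μ a horizontal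
-- strip, while in J the h's expand into J(ℓ , m + κ) summed over all κ, and the terms where m + κ is not such a strip
-- cancel in pairs because J is alternating in its columns.
-- Writing ∇ h_{ℓ-m} = ((ℓ + a) + (b - m)) h_{ℓ-m-1}, the Leibniz rule distributes the first summand over the rows and
-- the second over the columns: ∇ J(ℓ , m) = Σᵢ (ℓᵢ + a) J(ℓ - eᵢ , m) + Σⱼ (b - mⱼ) J(ℓ , m + eⱼ).
-- If λ - eᵢ or μ + eⱼ is not a partition, two rows or two columns coincide (or the last row is zero), so J vanishes.

open import Defs
open import Level using (Level; _⊔_)
open import Algebra.Bundles using (CommutativeRing)
open import Data.Bool using (Bool; true; false; _∧_; if_then_else_; T)
open import Data.Bool.ListAction using (and; all)
open import Data.List using (List; []; _∷_; [_]; _++_; map; length; upTo; concat; concatMap; drop; filter; zipWith; replicate)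
open import Data.List.Properties using (map-applyUpTo; map-cong; map-++; length-++; length-map; length-replicate)
open import Data.List.Relation.Unary.All as All using (All; []; _∷_)
open import Data.List.Relation.Unary.Any as Any using (Any; here; there)
open import Data.List.Relation.Unary.Linked as Linked using (Linked; []; [-]; _∷_)
open import Data.List.Relation.Unary.Linked.Properties using (Linked⇒All)
open import Data.Nat as ℕ using (ℕ; zero; suc; _∸_; _≤ᵇ_; _<ᵇ_; _≡ᵇ_; pred; s≤s; z≤n)
open import Data.Nat.ListAction using (sum)
open import Data.Nat.ListAction.Properties using (sum-++)
open import Data.Nat.Properties as ℕₚ using ()
open import Data.Nat.Tactic.RingSolver using (solve-∀)
open import Data.Product using (_×_; _,_; proj₁; proj₂)
open import Data.Sum using (_⊎_; inj₁; inj₂)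
open import Function using (_∘_; id)
open import Relation.Binary.Definitions using (tri<; tri≈; tri>)
open import Relation.Binary.PropositionalEquality as ≡ using (_≡_; _≢_)
open import Relation.Nullary using (yes; no; ¬_; contradiction)
open import Relation.Nullary.Decidable.Core using (T?)
import Algebra.Properties.AbelianGroup as AbelianGroupProperties
import Algebra.Properties.Ring as RingProperties
import Algebra.Solver.Ring.NaturalCoefficients.Default as SemiringSolver
import Relation.Binary.Reasoning.Setoid as SetoidReasoning

-- A series is its coefficient function on exponent lists, so expanding in the first variable means
-- evaluating at `k ∷ α`; the tableau sum and `J` are identified by induction on the exponent list,
-- from equal values at `[]` and equal recursions at `k ∷ α`. `IsNabla` constrains `D` only on
-- members of Λ, so `skewSchur la mu` must be known to be symmetric before `D` can be moved to the
-- determinant. No bijection on tableaux is used for this: membership is transported from `J`, which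
-- is built from the h's. Expansion along the first row gives alternation in the columns easily, but
-- not in the rows. Vanishing for equal rows or a zero row is therefore read off the coefficients:
-- the strip recursion changes only the columns, keeping them strictly decreasing and positive, and
-- then the constant term is nonzero only if `ls` equals `ms`. Only the differences ℓᵢ - mⱼ matter,
-- so both sequences are shifted by one constant into the positive naturals. Both partitions are
-- padded to a common length `K` exceeding either, which makes the matrix square and leaves room for
-- a new row of μ + eᵢ.

module Proof {c ℓ} (R : CommutativeRing c ℓ) where
  open SymFun R hiding (zero)
  open AbelianGroupProperties +-abelianGroup using (⁻¹-∙-comm)
  open RingProperties ring using (-1*x≈-x)
  open SetoidReasoning setoid
  open SemiringSolver commutativeSemiring using (solve; _:+_; _:*_; _:=_)

  -- Finite sums and linear functionals

  ΣL : ∀ {a} {A : Set a} → List A → (A → Carrier) → Carrier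
  ΣL xs f = sumR (map f xs)

  ΣL-cong : ∀ {a} {A : Set a} (xs : List A) {f g : A → Carrier} → (∀ x → f x ≈ g x) → ΣL xs f ≈ ΣL xs g
  ΣL-cong []       e = refl
  ΣL-cong (x ∷ xs) e = +-cong (e x) (ΣL-cong xs e)

  ΣL-0 : ∀ {a} {A : Set a} (xs : List A) → ΣL xs (λ _ → 0#) ≈ 0#
  ΣL-0 []       = refl
  ΣL-0 (x ∷ xs) = trans (+-identityˡ _) (ΣL-0 xs)

  ΣL-+ : ∀ {a} {A : Set a} (xs : List A) {f g : A → Carrier} → ΣL xs (λ x → f x + g x) ≈ ΣL xs f + ΣL xs g
  ΣL-+ []       = sym (+-identityˡ _)
  ΣL-+ (x ∷ xs) {f} {g} = trans (+-congˡ (ΣL-+ xs))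
    (solve 4 (λ a b u v → (a :+ b) :+ (u :+ v) := (a :+ u) :+ (b :+ v)) refl (f x) (g x) (ΣL xs f) (ΣL xs g))

  ΣL-* : ∀ {a} {A : Set a} (xs : List A) {f : A → Carrier} (r : Carrier) → ΣL xs (λ x → r * f x) ≈ r * ΣL xs f
  ΣL-* []       r = sym (zeroʳ r)
  ΣL-* (x ∷ xs) r = trans (+-congˡ (ΣL-* xs r)) (sym (distribˡ r _ _))

  ΣL-++ : ∀ {a} {A : Set a} (xs ys : List A) {f : A → Carrier} → ΣL (xs ++ ys) f ≈ ΣL xs f + ΣL ys f
  ΣL-++ []       ys = sym (+-identityˡ _)
  ΣL-++ (x ∷ xs) ys = trans (+-congˡ (ΣL-++ xs ys)) (sym (+-assoc _ _ _))

  ΣL-map : ∀ {a b} {A : Set a} {B : Set b} (xs : List A) (g : A → B) {f : B → Carrier} →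
           ΣL (map g xs) f ≈ ΣL xs (λ x → f (g x))
  ΣL-map []       g = refl
  ΣL-map (x ∷ xs) g = +-congˡ (ΣL-map xs g)

  ΣL-concatMap : ∀ {a b} {A : Set a} {B : Set b} (xs : List A) (g : A → List B) {f : B → Carrier} →
                 ΣL (concatMap g xs) f ≈ ΣL xs (λ x → ΣL (g x) f)
  ΣL-concatMap []       g = refl
  ΣL-concatMap (x ∷ xs) g = trans (ΣL-++ (g x) _) (+-congˡ (ΣL-concatMap xs g))

  ΣL-swap : ∀ {a b} {A : Set a} {B : Set b} (xs : List A) (ys : List B) {f : A → B → Carrier} →
            ΣL xs (λ x → ΣL ys (f x)) ≈ ΣL ys (λ y → ΣL xs (λ x → f x y))
  ΣL-swap []       ys = sym (ΣL-0 ys)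
  ΣL-swap (x ∷ xs) ys = trans (+-congˡ (ΣL-swap xs ys)) (sym (ΣL-+ ys))

  ΣL-upTo-suc : ∀ n (f : ℕ → Carrier) → ΣL (upTo (suc n)) f ≈ f 0 + ΣL (upTo n) (λ k → f (suc k))
  ΣL-upTo-suc n f = +-congˡ (reflexive (≡.cong sumR
    (≡.trans (map-applyUpTo suc f n) (≡.sym (map-applyUpTo id (f ∘ suc) n)))))

  -- Finite linear combinations of evaluations, i.e. functionals of the form Φ ↦ Σ cᵢ Φ(xᵢ):
  -- linearity and the interchange of any two such operators come for free.
  record Lin {A : Set} (T : (A → Carrier) → Carrier) : Set (c ⊔ ℓ) where
    constructor mkLin
    field
      coef   : List (Carrier × A)
      rep    : ∀ Φ → T Φ ≈ ΣL coef (λ p → proj₁ p * Φ (proj₂ p))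

  module _ {A : Set} where

    lin-eval : (x : A) → Lin (λ Φ → Φ x)
    lin-eval x = mkLin [ 1# , x ] λ Φ → sym (trans (+-identityʳ _) (*-identityˡ _))

    lin-0 : Lin {A} (λ _ → 0#)
    lin-0 = mkLin [] λ _ → refl

    lin-+ : {S T : (A → Carrier) → Carrier} → Lin S → Lin T → Lin (λ Φ → S Φ + T Φ)
    lin-+ (mkLin s es) (mkLin t et) = mkLin (s ++ t) λ Φ →
      trans (+-cong (es Φ) (et Φ)) (sym (ΣL-++ s t))

    lin-* : {T : (A → Carrier) → Carrier} (r : Carrier) → Lin T → Lin (λ Φ → r * T Φ)
    lin-* r (mkLin t et) = mkLin (map (λ p → r * proj₁ p , proj₂ p) t) λ Φ →
      trans (*-congˡ (et Φ)) (sym (trans (ΣL-map t _)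
        (trans (ΣL-cong t (λ p → *-assoc r (proj₁ p) _)) (ΣL-* t r))))

    lin-ΣL : ∀ {b} {B : Set b} (ys : List B) {T : B → (A → Carrier) → Carrier} →
             (∀ y → Lin (T y)) → Lin (λ Φ → ΣL ys (λ y → T y Φ))
    lin-ΣL []       l = lin-0
    lin-ΣL (y ∷ ys) l = lin-+ (l y) (lin-ΣL ys l)

    lin-cong : {T : (A → Carrier) → Carrier} → Lin T → ∀ {Φ Ψ} → (∀ x → Φ x ≈ Ψ x) → T Φ ≈ T Ψ
    lin-cong (mkLin t et) e =
      trans (et _) (trans (ΣL-cong t (λ p → *-congˡ (e (proj₂ p)))) (sym (et _)))

    lin-add : {T : (A → Carrier) → Carrier} → Lin T → ∀ Φ Ψ → T (λ x → Φ x + Ψ x) ≈ T Φ + T Ψ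
    lin-add (mkLin t et) Φ Ψ = begin
      _ ≈⟨ et _ ⟩
      _ ≈⟨ ΣL-cong t (λ p → distribˡ _ _ _) ⟩
      _ ≈⟨ ΣL-+ t ⟩
      _ ≈⟨ +-cong (et Φ) (et Ψ) ⟨
      _ ∎

    lin-scale : {T : (A → Carrier) → Carrier} → Lin T → ∀ r Φ → T (λ x → r * Φ x) ≈ r * T Φ
    lin-scale (mkLin t et) r Φ = begin
      _ ≈⟨ et _ ⟩
      _ ≈⟨ ΣL-cong t (λ p → solve 3 (λ u v w → u :* (v :* w) := v :* (u :* w)) refl (proj₁ p) r (Φ (proj₂ p))) ⟩
      _ ≈⟨ ΣL-* t r ⟩
      _ ≈⟨ *-congˡ (et Φ) ⟨
      _ ∎

    lin-zero : {T : (A → Carrier) → Carrier} → Lin T → ∀ {Φ} → (∀ x → Φ x ≈ 0#) → T Φ ≈ 0#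
    lin-zero (mkLin t et) e =
      trans (et _) (trans (ΣL-cong t (λ p → trans (*-congˡ (e (proj₂ p))) (zeroʳ _))) (ΣL-0 t))

  lin-swap : {A B : Set} {S : (A → Carrier) → Carrier} {T : (B → Carrier) → Carrier} →
             Lin S → Lin T → ∀ (F : A → B → Carrier) →
             S (λ x → T (F x)) ≈ T (λ y → S (λ x → F x y))
  lin-swap {S = S} {T} ls@(mkLin s es) lt@(mkLin t et) F = begin
    S (λ x → T (F x))
      ≈⟨ es _ ⟩
    ΣL s (λ p → proj₁ p * T (F (proj₂ p)))
      ≈⟨ ΣL-cong s (λ p → sym (lin-scale lt (proj₁ p) _)) ⟩
    ΣL s (λ p → T (λ y → proj₁ p * F (proj₂ p) y))
      ≈⟨ ΣL-cong s (λ p → et _) ⟩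
    ΣL s (λ p → ΣL t (λ q → proj₁ q * (proj₁ p * F (proj₂ p) (proj₂ q))))
      ≈⟨ ΣL-swap s t ⟩
    ΣL t (λ q → ΣL s (λ p → proj₁ q * (proj₁ p * F (proj₂ p) (proj₂ q))))
      ≈⟨ ΣL-cong t (λ q → ΣL-* s (proj₁ q)) ⟩
    ΣL t (λ q → proj₁ q * ΣL s (λ p → proj₁ p * F (proj₂ p) (proj₂ q)))
      ≈⟨ ΣL-cong t (λ q → *-congˡ (es _)) ⟨
    ΣL t (λ q → proj₁ q * S (λ x → F x (proj₂ q)))
      ≈⟨ et _ ⟨
    T (λ y → S (λ x → F x y)) ∎

  ind : Bool → Carrier
  ind b = if b then 1# else 0#

  ind-∧ : ∀ b b′ → ind (b ∧ b′) ≈ ind b * ind b′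
  ind-∧ false b′ = sym (zeroˡ _)
  ind-∧ true  b′ = sym (*-identityˡ _)

  -- Σ F i r over i + r = k.
  conv : ℕ → (ℕ → ℕ → Carrier) → Carrier
  conv zero    F = F 0 0
  conv (suc k) F = F 0 (suc k) + conv k (λ i → F (suc i))

  conv-cong≡ : ∀ k {F G : ℕ → ℕ → Carrier} → (∀ i r → i ℕ.+ r ≡ k → F i r ≈ G i r) → conv k F ≈ conv k G
  conv-cong≡ zero    e = e 0 0 ≡.refl
  conv-cong≡ (suc k) e = +-cong (e 0 (suc k) ≡.refl) (conv-cong≡ k (λ i r p → e (suc i) r (≡.cong suc p)))

  conv-cong : ∀ k {F G : ℕ → ℕ → Carrier} → (∀ i r → F i r ≈ G i r) → conv k F ≈ conv k G
  conv-cong k e = conv-cong≡ k (λ i r _ → e i r)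

  lin-conv : ∀ {A : Set} k {T : ℕ → ℕ → (A → Carrier) → Carrier} →
             (∀ i r → Lin (T i r)) → Lin (λ Φ → conv k (λ i r → T i r Φ))
  lin-conv zero    l = l 0 0
  lin-conv (suc k) l = lin-+ (l 0 (suc k)) (lin-conv k (λ i → l (suc i)))

  conv-lin : ∀ k → Lin {ℕ × ℕ} (λ Φ → conv k (λ i r → Φ (i , r)))
  conv-lin k = lin-conv k (λ i r → lin-eval (i , r))

  conv-+ : ∀ k (F G : ℕ → ℕ → Carrier) → conv k (λ i r → F i r + G i r) ≈ conv k F + conv k G
  conv-+ k F G = lin-add (conv-lin k) (λ p → F (proj₁ p) (proj₂ p)) (λ p → G (proj₁ p) (proj₂ p))

  conv-* : ∀ k c′ (F : ℕ → ℕ → Carrier) → conv k (λ i r → c′ * F i r) ≈ c′ * conv k F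
  conv-* k c′ F = lin-scale (conv-lin k) c′ (λ p → F (proj₁ p) (proj₂ p))

  conv-0 : ∀ k {F : ℕ → ℕ → Carrier} → (∀ i r → F i r ≈ 0#) → conv k F ≈ 0#
  conv-0 k e = lin-zero (conv-lin k) (λ p → e (proj₁ p) (proj₂ p))

  conv-first : ∀ k {F : ℕ → ℕ → Carrier} → (∀ i r → F (suc i) r ≈ 0#) → conv k F ≈ F 0 k
  conv-first zero    e = refl
  conv-first (suc k) e = trans (+-congˡ (conv-0 k e)) (+-identityʳ _)

  conv-last : ∀ k {F : ℕ → ℕ → Carrier} → (∀ i r → F i (suc r) ≈ 0#) → conv k F ≈ F k 0
  conv-last zero    e = refl
  conv-last (suc k) e = trans (+-cong (e 0 k) (conv-last k (λ i → e (suc i)))) (+-identityˡ _)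

  ΣL-conv : ∀ k (F : ℕ → ℕ → Carrier) → ΣL (upTo (suc k)) (λ i → F i (k ∸ i)) ≈ conv k F
  ΣL-conv zero    F = +-identityʳ _
  ΣL-conv (suc k) F = trans (ΣL-upTo-suc (suc k) (λ i → F i (suc k ∸ i))) (+-congˡ (ΣL-conv k (λ i → F (suc i))))

  convTail : ℕ → (ℕ → ℕ → Carrier) → Carrier
  convTail zero    F = 0#
  convTail (suc r) F = conv r (λ j → F (suc j))

  conv-split : ∀ r (F : ℕ → ℕ → Carrier) → conv r F ≈ F 0 r + convTail r F
  conv-split zero    F = sym (+-identityʳ _)
  conv-split (suc r) F = refl

  -- The term with r = 0 has an empty tail, so the outer total drops from `suc k` to `k`.
  conv-convTail : ∀ k (X : ℕ → ℕ → ℕ → Carrier) →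
    conv (suc k) (λ i r → convTail r (X i)) ≈ conv k (λ i r → conv r (λ j → X i (suc j)))
  conv-convTail zero    X = +-identityʳ _
  conv-convTail (suc k) X = +-congˡ (conv-convTail k (λ i → X (suc i)))

  -- Both sides sum `X i j s` over i + j + s = k. The inner range depends on the outer index, so
  -- `lin-swap` does not apply; instead the slice i = 0 is peeled off, as the outermost term on the
  -- left and from each inner sum on the right.
  conv-exchange : ∀ k (X : ℕ → ℕ → ℕ → Carrier) →
    conv k (λ i r → conv r (X i)) ≈ conv k (λ j r → conv r (λ i → X i j))
  conv-exchange zero    X = refl
  conv-exchange (suc k) X = begin
    conv (suc k) (X 0) + conv k (λ i r → conv r (X (suc i)))
      ≈⟨ +-congˡ (conv-exchange k (λ i → X (suc i))) ⟩
    (X 0 0 (suc k) + conv k (λ j → X 0 (suc j))) + conv k (λ j r → conv r (λ i → X (suc i) j))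
      ≈⟨ +-assoc _ _ _ ⟩
    X 0 0 (suc k) + (conv k (λ j → X 0 (suc j)) + conv k (λ j r → conv r (λ i → X (suc i) j)))
      ≈⟨ +-congˡ (+-congˡ (sym (conv-convTail k (λ j i → X i j)))) ⟩
    X 0 0 (suc k) + (conv k (λ j → X 0 (suc j)) + conv (suc k) (λ j r → convTail r (λ i → X i j)))
      ≈⟨ +-assoc _ _ _ ⟨
    conv (suc k) (X 0) + conv (suc k) (λ j r → convTail r (λ i → X i j))
      ≈⟨ conv-+ (suc k) (X 0) (λ j r → convTail r (λ i → X i j)) ⟨
    conv (suc k) (λ j r → X 0 j r + convTail r (λ i → X i j))
      ≈⟨ conv-cong (suc k) (λ j r → sym (conv-split r (λ i → X i j))) ⟩
    conv (suc k) (λ j r → conv r (λ i → X i j)) ∎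

  -- Induction removes the border where i = 0 or j = 0: its corner vanishes, its two arms cancel,
  -- and what remains has total smaller by two. The diagonal needs its own hypothesis because 2 may
  -- be a zero divisor in the ring.
  conv-antisym : ∀ k (X : ℕ → ℕ → ℕ → Carrier) → (∀ i s → X i i s ≈ 0#) →
    (∀ i j s → X i j s + X j i s ≈ 0#) → conv k (λ i r → conv r (X i)) ≈ 0#
  conv-antisym zero          X d a = d 0 0
  conv-antisym (suc zero)    X d a = begin
    (X 0 0 1 + X 0 1 0) + X 1 0 0 ≈⟨ +-congʳ (+-congʳ (d 0 1)) ⟩
    (0# + X 0 1 0) + X 1 0 0      ≈⟨ +-congʳ (+-identityˡ _) ⟩
    X 0 1 0 + X 1 0 0             ≈⟨ a 0 1 0 ⟩
    0# ∎
  conv-antisym (suc (suc k)) X d a = begin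
    (X 0 0 (suc (suc k)) + conv (suc k) (λ j → X 0 (suc j))) + conv (suc k) (λ i r → conv r (X (suc i)))
      ≈⟨ +-cong (trans (+-congʳ (d 0 _)) (+-identityˡ _))
           (trans (conv-cong (suc k) (λ i r → conv-split r (X (suc i))))
                  (conv-+ (suc k) (λ i r → X (suc i) 0 r) (λ i r → convTail r (X (suc i))))) ⟩
    conv (suc k) (λ j → X 0 (suc j)) +
      (conv (suc k) (λ i → X (suc i) 0) + conv (suc k) (λ i r → convTail r (X (suc i))))
      ≈⟨ +-assoc _ _ _ ⟨
    (conv (suc k) (λ j → X 0 (suc j)) + conv (suc k) (λ i → X (suc i) 0)) +
      conv (suc k) (λ i r → convTail r (X (suc i)))
      ≈⟨ +-cong (sym (conv-+ (suc k) (λ j → X 0 (suc j)) (λ i → X (suc i) 0))) (conv-convTail k (λ i → X (suc i))) ⟩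
    conv (suc k) (λ j s → X 0 (suc j) s + X (suc j) 0 s) + conv k (λ i r → conv r (λ j → X (suc i) (suc j)))
      ≈⟨ +-cong (conv-0 (suc k) (λ j s → a 0 (suc j) s))
           (conv-antisym k (λ i j → X (suc i) (suc j)) (λ i → d (suc i)) (λ i j → a (suc i) (suc j))) ⟩
    0# + 0# ≈⟨ +-identityˡ _ ⟩
    0# ∎

  -- Only the terms with j < d survive when the others cancel under (i , d + j) ↔ (j , d + i).
  conv-cut : ∀ d k (X : ℕ → ℕ → ℕ → Carrier) → (∀ i s → X i (d ℕ.+ i) s ≈ 0#) →
    (∀ i j s → X i (d ℕ.+ j) s + X j (d ℕ.+ i) s ≈ 0#) →
    conv k (λ i r → conv r (X i)) ≈ conv k (λ i r → conv r (λ j s → ind (j <ᵇ d) * X i j s))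
  conv-cut d k X e a = begin
    conv k (λ i r → conv r (X i))                     ≈⟨ conv-exchange k X ⟩
    conv k (λ j r → conv r (λ i → X i j))             ≈⟨ go d k X e a ⟩
    conv k (λ j r → conv r (λ i s → ind (j <ᵇ d) * X i j s)) ≈⟨ conv-exchange k (λ i j s → ind (j <ᵇ d) * X i j s) ⟨
    conv k (λ i r → conv r (λ j s → ind (j <ᵇ d) * X i j s)) ∎
    where
    -- With j as the outer index, induction on `d` keeps the slices j = 0, ..., d - 1 one at a time;
    -- at d = 0 the rest is antisymmetric and cancels.
    go : ∀ d k (X : ℕ → ℕ → ℕ → Carrier) → (∀ i s → X i (d ℕ.+ i) s ≈ 0#) →
      (∀ i j s → X i (d ℕ.+ j) s + X j (d ℕ.+ i) s ≈ 0#) →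
      conv k (λ j r → conv r (λ i → X i j)) ≈ conv k (λ j r → conv r (λ i s → ind (j <ᵇ d) * X i j s))
    go zero    k X e a = trans (conv-antisym k (λ j i → X i j) e (λ i j s → a j i s))
      (sym (conv-0 k (λ j r → conv-0 r (λ i s → zeroˡ _))))
    go (suc d) zero    X e a = sym (*-identityˡ _)
    go (suc d) (suc k) X e a = +-cong (conv-cong (suc k) {λ i → X i 0} (λ i s → sym (*-identityˡ _)))
      (go d k (λ i j → X i (suc j)) e a)

  -- Symmetric series

  slice : Series → ℕ → Series
  slice f j α = f (j ∷ α)

  -- The Cauchy product in the first variable alone, with slices as coefficients; inductions on the
  -- exponent list pass through products by this rule.
  ⊛-∷ : ∀ f g k α → (f ⊛ g) (k ∷ α) ≈ conv k (λ i r → (slice f i ⊛ slice g r) α)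
  ⊛-∷ f g k α = begin
    ΣL (concatMap (λ y → map (y ∷_) (below α)) (upTo (suc k))) F
      ≈⟨ ΣL-concatMap (upTo (suc k)) (λ y → map (y ∷_) (below α)) {F} ⟩
    ΣL (upTo (suc k)) (λ y → ΣL (map (y ∷_) (below α)) F)
      ≈⟨ ΣL-cong (upTo (suc k)) (λ y → ΣL-map (below α) (y ∷_)) ⟩
    ΣL (upTo (suc k)) (λ y → (slice f y ⊛ slice g (k ∸ y)) α)
      ≈⟨ ΣL-conv k (λ i r → (slice f i ⊛ slice g r) α) ⟩
    conv k (λ i r → (slice f i ⊛ slice g r) α) ∎
    where
    F : List ℕ → Carrier
    F β = f β * g (zipWith _∸_ (k ∷ α) β)

  ⊛-[] : ∀ f g → (f ⊛ g) [] ≈ f [] * g []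
  ⊛-[] f g = +-identityʳ _

  lin-⊛ʳ : ∀ f α → Lin (λ g → (f ⊛ g) α)
  lin-⊛ʳ f α = lin-ΣL (below α) (λ β → lin-* (f β) (lin-eval (zipWith _∸_ α β)))

  ⊛-congʳ : ∀ f {g g′} → g ≋ g′ → (f ⊛ g) ≋ (f ⊛ g′)
  ⊛-congʳ f e α = lin-cong (lin-⊛ʳ f α) e

  ⊛-congˡ : ∀ {f f′} g → f ≋ f′ → (f ⊛ g) ≋ (f′ ⊛ g)
  ⊛-congˡ g e α = ΣL-cong (below α) (λ β → *-congʳ (e β))

  ⊛-zeroˡ : ∀ {f} g α → (∀ β → f β ≈ 0#) → (f ⊛ g) α ≈ 0#
  ⊛-zeroˡ g α e = trans (ΣL-cong (below α) (λ β → trans (*-congʳ (e β)) (zeroˡ _))) (ΣL-0 (below α))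

  ⊛-zeroʳ : ∀ f {g} α → (∀ β → g β ≈ 0#) → (f ⊛ g) α ≈ 0#
  ⊛-zeroʳ f α e = lin-zero (lin-⊛ʳ f α) e

  ⊛-·ˡ : ∀ r f g α → ((r · f) ⊛ g) α ≈ r * (f ⊛ g) α
  ⊛-·ˡ r f g α = trans (ΣL-cong (below α) (λ β → *-assoc r _ _)) (ΣL-* (below α) r)

  h0-slice : ∀ r → (slice (h 0) (suc r)) ≋ zeroS
  h0-slice r α = refl

  ⊛-h0 : ∀ f → (f ⊛ h 0) ≋ f
  ⊛-h0 f []      = trans (⊛-[] f (h 0)) (*-identityʳ _)
  ⊛-h0 f (k ∷ α) = begin
    (f ⊛ h 0) (k ∷ α)                                  ≈⟨ ⊛-∷ f (h 0) k α ⟩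
    conv k (λ i r → (slice f i ⊛ slice (h 0) r) α)     ≈⟨ conv-last k (λ i r → ⊛-zeroʳ (slice f i) α (h0-slice r)) ⟩
    (slice f k ⊛ h 0) α                                ≈⟨ ⊛-h0 (slice f k) α ⟩
    f (k ∷ α) ∎

  h0-⊛ : ∀ f → (h 0 ⊛ f) ≋ f
  h0-⊛ f []      = trans (⊛-[] (h 0) f) (*-identityˡ _)
  h0-⊛ f (k ∷ α) = begin
    (h 0 ⊛ f) (k ∷ α)                                  ≈⟨ ⊛-∷ (h 0) f k α ⟩
    conv k (λ i r → (slice (h 0) i ⊛ slice f r) α)     ≈⟨ conv-first k (λ i r → ⊛-zeroˡ (slice f r) α (h0-slice i)) ⟩
    (h 0 ⊛ slice f k) α                                ≈⟨ h0-⊛ (slice f k) α ⟩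
    f (k ∷ α) ∎

  -- `IsΛ` without the degree bound: this part passes unchanged to slices, so products can be
  -- treated by induction on the exponents.
  record Sym (f : Series) : Set (c ⊔ ℓ) where
    constructor mkSym
    field
      pad  : ∀ α → f (α ++ [ 0 ]) ≈ f α
      swap : ∀ k α → f (swapAt k α) ≈ f α
  open Sym

  slice-Sym : ∀ {f} → Sym f → ∀ j → Sym (slice f j)
  slice-Sym s j = mkSym (λ α → pad s (j ∷ α)) (λ k α → swap s (suc k) (j ∷ α))

  ⊛-pad : ∀ {f g} → Sym f → Sym g → ∀ α → (f ⊛ g) (α ++ [ 0 ]) ≈ (f ⊛ g) α
  ⊛-pad {f} {g} sf sg []      = +-congʳ (*-cong (pad sf []) (pad sg []))
  ⊛-pad {f} {g} sf sg (k ∷ α) = begin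
    _ ≈⟨ ⊛-∷ f g k (α ++ [ 0 ]) ⟩
    _ ≈⟨ conv-cong k (λ i r → ⊛-pad (slice-Sym sf i) (slice-Sym sg r) α) ⟩
    _ ≈⟨ ⊛-∷ f g k α ⟨
    _ ∎

  ⊛-∷∷ : ∀ f g x y α → (f ⊛ g) (x ∷ y ∷ α) ≈
         conv x (λ i r → conv y (λ j s → (slice (slice f i) j ⊛ slice (slice g r) s) α))
  ⊛-∷∷ f g x y α = trans (⊛-∷ f g x (y ∷ α)) (conv-cong x (λ i r → ⊛-∷ (slice f i) (slice g r) y α))

  ⊛-swap : ∀ k {f g} → Sym f → Sym g → ∀ α → (f ⊛ g) (swapAt k α) ≈ (f ⊛ g) α
  ⊛-swap zero    {f} {g} sf sg []      = refl
  ⊛-swap zero    {f} {g} sf sg (x ∷ []) = begin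
    (f ⊛ g) (0 ∷ x ∷ [])
      ≈⟨ ⊛-∷∷ f g 0 x [] ⟩
    conv x (λ j s → (slice (slice f 0) j ⊛ slice (slice g 0) s) [])
      ≈⟨ conv-cong x (λ j s → +-congʳ (*-cong (swap sf 0 (j ∷ [])) (swap sg 0 (s ∷ [])))) ⟩
    conv x (λ j s → (slice f j ⊛ slice g s) [])
      ≈⟨ ⊛-∷ f g x [] ⟨
    (f ⊛ g) (x ∷ []) ∎
  ⊛-swap zero    {f} {g} sf sg (x ∷ y ∷ α) = begin
    (f ⊛ g) (y ∷ x ∷ α)
      ≈⟨ ⊛-∷∷ f g y x α ⟩
    conv y (λ j s → conv x (λ i r → (slice (slice f j) i ⊛ slice (slice g s) r) α))
      ≈⟨ lin-swap (conv-lin y) (conv-lin x)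
           (λ p q → (slice (slice f (proj₁ p)) (proj₁ q) ⊛ slice (slice g (proj₂ p)) (proj₂ q)) α) ⟩
    conv x (λ i r → conv y (λ j s → (slice (slice f j) i ⊛ slice (slice g s) r) α))
      ≈⟨ conv-cong x (λ i r → conv-cong y (λ j s →
           trans (⊛-congˡ (slice (slice g s) r) (λ β → swap sf 0 (i ∷ j ∷ β)) α)
                 (⊛-congʳ (slice (slice f i) j) (λ β → swap sg 0 (r ∷ s ∷ β)) α))) ⟩
    conv x (λ i r → conv y (λ j s → (slice (slice f i) j ⊛ slice (slice g r) s) α))
      ≈⟨ ⊛-∷∷ f g x y α ⟨
    (f ⊛ g) (x ∷ y ∷ α) ∎
  -- Here `swapAt` lengthens the empty list, so padding invariance has to remove the extra zero at
  -- the end.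
  ⊛-swap (suc k) {f} {g} sf sg []      = begin
    (f ⊛ g) (0 ∷ swapAt k [])              ≈⟨ ⊛-∷ f g 0 (swapAt k []) ⟩
    (slice f 0 ⊛ slice g 0) (swapAt k [])  ≈⟨ ⊛-swap k (slice-Sym sf 0) (slice-Sym sg 0) [] ⟩
    (slice f 0 ⊛ slice g 0) []             ≈⟨ ⊛-∷ f g 0 [] ⟨
    (f ⊛ g) (0 ∷ [])                       ≈⟨ ⊛-pad sf sg [] ⟩
    (f ⊛ g) [] ∎
  ⊛-swap (suc k) {f} {g} sf sg (x ∷ α) = begin
    _ ≈⟨ ⊛-∷ f g x (swapAt k α) ⟩
    _ ≈⟨ conv-cong x (λ i r → ⊛-swap k (slice-Sym sf i) (slice-Sym sg r) α) ⟩
    _ ≈⟨ ⊛-∷ f g x α ⟨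
    _ ∎

  -- `u` and `v` record the exponents already sliced off `f` and `g`; counting them on the right of
  -- the inequality avoids truncated degrees d - u and e - v.
  ⊛-bounded : ∀ {d e} u v {f g} → (∀ β → d ℕ.< u ℕ.+ sum β → f β ≈ 0#) →
    (∀ γ → e ℕ.< v ℕ.+ sum γ → g γ ≈ 0#) →
    ∀ α → d ℕ.+ e ℕ.< (u ℕ.+ v) ℕ.+ sum α → (f ⊛ g) α ≈ 0#
  ⊛-bounded {d} {e} u v {f} {g} bf bg [] lt with d ℕₚ.<? u
  ... | yes p = trans (⊛-[] f g) (trans (*-congʳ (bf [] (≡.subst (d ℕ.<_) (≡.sym (ℕₚ.+-identityʳ u)) p))) (zeroˡ _))
  ... | no ¬p = trans (⊛-[] f g) (trans (*-congˡ (bg [] (≡.subst (e ℕ.<_) (≡.sym (ℕₚ.+-identityʳ v)) e<v))) (zeroʳ _))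
    where
    e<v : e ℕ.< v
    e<v = ℕₚ.≰⇒> λ v≤e → ℕₚ.<⇒≱ (≡.subst (d ℕ.+ e ℕ.<_) (ℕₚ.+-identityʳ _) lt)
                          (ℕₚ.+-mono-≤ (ℕₚ.≮⇒≥ ¬p) v≤e)
  ⊛-bounded {d} {e} u v {f} {g} bf bg (k ∷ α) lt = trans (⊛-∷ f g k α)
    (trans (conv-cong≡ k {G = λ _ _ → 0#} step) (conv-0 k (λ _ _ → refl)))
    where
    step : ∀ i r → i ℕ.+ r ≡ k → (slice f i ⊛ slice g r) α ≈ 0#
    step i r eq = ⊛-bounded (u ℕ.+ i) (v ℕ.+ r)
      (λ β p → bf (i ∷ β) (≡.subst (d ℕ.<_) (ℕₚ.+-assoc u i _) p))
      (λ β p → bg (r ∷ β) (≡.subst (e ℕ.<_) (ℕₚ.+-assoc v r _) p)) α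
      (≡.subst (d ℕ.+ e ℕ.<_) shuffle lt)
      where
      lem : ∀ u v i r s → u ℕ.+ v ℕ.+ (i ℕ.+ r ℕ.+ s) ≡ u ℕ.+ i ℕ.+ (v ℕ.+ r) ℕ.+ s
      lem = solve-∀
      shuffle : u ℕ.+ v ℕ.+ (k ℕ.+ sum α) ≡ u ℕ.+ i ℕ.+ (v ℕ.+ r) ℕ.+ sum α
      shuffle = ≡.trans (≡.cong (λ z → u ℕ.+ v ℕ.+ (z ℕ.+ sum α)) (≡.sym eq)) (lem u v i r (sum α))

  Λ-Sym : ∀ {f} → IsΛ f → Sym f
  Λ-Sym l = mkSym (IsΛ.padInv l) (IsΛ.swapInv l)

  <⇒<ᵇ≡true : ∀ {m n} → m ℕ.< n → (m <ᵇ n) ≡ true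
  <⇒<ᵇ≡true {m} {n} p with m <ᵇ n | ℕₚ.<⇒<ᵇ p
  ... | true | _ = ≡.refl

  <ᵇ≡true⇒< : ∀ m n → (m <ᵇ n) ≡ true → m ℕ.< n
  <ᵇ≡true⇒< m n e = ℕₚ.<ᵇ⇒< m n (≡.subst T (≡.sym e) _)

  Λ-⊛ : ∀ {f g} → IsΛ f → IsΛ g → IsΛ (f ⊛ g)
  Λ-⊛ {f} {g} lf lg = record
    { padInv  = ⊛-pad (Λ-Sym lf) (Λ-Sym lg)
    ; swapInv = λ k → ⊛-swap k (Λ-Sym lf) (Λ-Sym lg)
    ; deg     = IsΛ.deg lf ℕ.+ IsΛ.deg lg
    ; bounded = λ α p → ⊛-bounded 0 0
        (λ β q → IsΛ.bounded lf β (<⇒<ᵇ≡true q))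
        (λ β q → IsΛ.bounded lg β (<⇒<ᵇ≡true q)) α (<ᵇ≡true⇒< (IsΛ.deg lf ℕ.+ IsΛ.deg lg) (sum α) p)
    }

  Λ-⊕ : ∀ {f g} → IsΛ f → IsΛ g → IsΛ (f ⊕ g)
  Λ-⊕ {f} {g} lf lg = record
    { padInv  = λ α → +-cong (IsΛ.padInv lf α) (IsΛ.padInv lg α)
    ; swapInv = λ k α → +-cong (IsΛ.swapInv lf k α) (IsΛ.swapInv lg k α)
    ; deg     = IsΛ.deg lf ℕ.+ IsΛ.deg lg
    ; bounded = λ α p → let q = <ᵇ≡true⇒< (IsΛ.deg lf ℕ.+ IsΛ.deg lg) (sum α) p in
        trans (+-cong (IsΛ.bounded lf α (<⇒<ᵇ≡true (ℕₚ.≤-<-trans (ℕₚ.m≤m+n _ _) q)))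
                      (IsΛ.bounded lg α (<⇒<ᵇ≡true (ℕₚ.≤-<-trans (ℕₚ.m≤n+m _ (IsΛ.deg lf)) q))))
              (+-identityˡ _)
    }

  Λ-· : ∀ r {f} → IsΛ f → IsΛ (r · f)
  Λ-· r l = record
    { padInv  = λ α → *-congˡ (IsΛ.padInv l α)
    ; swapInv = λ k α → *-congˡ (IsΛ.swapInv l k α)
    ; deg     = IsΛ.deg l
    ; bounded = λ α p → trans (*-congˡ (IsΛ.bounded l α p)) (zeroʳ r)
    }

  Λ-zero : IsΛ zeroS
  Λ-zero = record { padInv = λ _ → refl ; swapInv = λ _ _ → refl ; deg = 0 ; bounded = λ _ _ → refl }

  Λ-resp : ∀ {f g} → f ≋ g → IsΛ f → IsΛ g
  Λ-resp e l = record
    { padInv  = λ α → trans (sym (e _)) (trans (IsΛ.padInv l α) (e α))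
    ; swapInv = λ k α → trans (sym (e _)) (trans (IsΛ.swapInv l k α) (e α))
    ; deg     = IsΛ.deg l
    ; bounded = λ α p → trans (sym (e α)) (IsΛ.bounded l α p)
    }

  sum-swapAt : ∀ k α → sum (swapAt k α) ≡ sum α
  sum-swapAt zero    []          = ≡.refl
  sum-swapAt zero    (x ∷ [])    = ≡.refl
  sum-swapAt zero    (x ∷ y ∷ α) = ≡.trans (≡.sym (ℕₚ.+-assoc y x _)) 
    (≡.trans (≡.cong (ℕ._+ sum α) (ℕₚ.+-comm y x)) (ℕₚ.+-assoc x y _))
  sum-swapAt (suc k) []      = sum-swapAt k []
  sum-swapAt (suc k) (x ∷ α) = ≡.cong (x ℕ.+_) (sum-swapAt k α)

  ≡ᵇ-refl : ∀ n → (n ≡ᵇ n) ≡ true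
  ≡ᵇ-refl zero    = ≡.refl
  ≡ᵇ-refl (suc n) = ≡ᵇ-refl n

  ≢⇒≡ᵇ-false : ∀ m n → m ≢ n → (m ≡ᵇ n) ≡ false
  ≢⇒≡ᵇ-false zero    zero    p = contradiction ≡.refl p
  ≢⇒≡ᵇ-false zero    (suc n) p = ≡.refl
  ≢⇒≡ᵇ-false (suc m) zero    p = ≡.refl
  ≢⇒≡ᵇ-false (suc m) (suc n) p = ≢⇒≡ᵇ-false m n (p ∘ ≡.cong suc)

  -- hh ℓ m is h_{ℓ-m}, which vanishes for m > ℓ.
  hh : ℕ → ℕ → Series
  hh ℓ m α = ind (m ℕ.+ sum α ≡ᵇ ℓ)

  hh-slice : ∀ ℓ m j → slice (hh ℓ m) j ≋ hh ℓ (m ℕ.+ j)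
  hh-slice ℓ m j α = reflexive (≡.cong (λ z → ind (z ≡ᵇ ℓ)) (≡.sym (ℕₚ.+-assoc m j (sum α))))

  hh-zero : ∀ {ℓ m} → ℓ ℕ.< m → hh ℓ m ≋ zeroS
  hh-zero {ℓ} {m} p α = reflexive (≡.cong ind (≢⇒≡ᵇ-false _ _
    λ e → ℕₚ.<⇒≱ p (≡.subst (m ℕ.≤_) e (ℕₚ.m≤m+n m _))))

  +-≡ᵇ : ∀ m x y → (m ℕ.+ x ≡ᵇ m ℕ.+ y) ≡ (x ≡ᵇ y)
  +-≡ᵇ zero    x y = ≡.refl
  +-≡ᵇ (suc m) x y = +-≡ᵇ m x y

  hh-h : ∀ m n → hh (m ℕ.+ n) m ≋ h n
  hh-h m n α = reflexive (≡.cong ind (+-≡ᵇ m (sum α) n))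

  Λ-hh : ∀ ℓ m → IsΛ (hh ℓ m)
  Λ-hh ℓ m = record
    { padInv  = λ α → reflexive (≡.cong (λ z → ind (m ℕ.+ z ≡ᵇ ℓ))
                  (≡.trans (sum-++ α [ 0 ]) (ℕₚ.+-identityʳ _)))
    ; swapInv = λ k α → reflexive (≡.cong (λ z → ind (m ℕ.+ z ≡ᵇ ℓ)) (sum-swapAt k α))
    ; deg     = ℓ
    ; bounded = λ α p → reflexive (≡.cong ind (≢⇒≡ᵇ-false _ _
        λ e → ℕₚ.<⇒≱ (<ᵇ≡true⇒< ℓ (sum α) p) (≡.subst (sum α ℕ.≤_) e (ℕₚ.m≤n+m (sum α) m))))
    }

  -- The Jacobi–Trudi determinant and ∇

  -- The shape of a Laplace expansion: one entry is singled out, the others form the minor, and each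
  -- entry passed over costs a sign. The version on series is the one `D` acts on; its
  -- coefficientwise twin `alt` is the one that is a `Lin` functional.
  altS : (ℕ → List ℕ → Series) → List ℕ → Series
  altS f []       = zeroS
  altS f (x ∷ xs) = f x xs ⊕ ((- 1#) · altS (λ y ys → f y (x ∷ ys)) xs)

  alt : (ℕ → List ℕ → Carrier) → List ℕ → Carrier
  alt f []       = 0#
  alt f (x ∷ xs) = f x xs + - 1# * alt (λ y ys → f y (x ∷ ys)) xs

  altS-at : ∀ f xs α → altS f xs α ≡ alt (λ y ys → f y ys α) xs
  altS-at f []       α = ≡.refl
  altS-at f (x ∷ xs) α = ≡.cong (λ z → f x xs α + - 1# * z) (altS-at (λ y ys → f y (x ∷ ys)) xs α)

  lin-alt : ∀ {A : Set} xs {T : ℕ → List ℕ → (A → Carrier) → Carrier} →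
            (∀ y ys → Lin (T y ys)) → Lin (λ Φ → alt (λ y ys → T y ys Φ) xs)
  lin-alt []       l = lin-0
  lin-alt (x ∷ xs) l = lin-+ (l x xs) (lin-* (- 1#) (lin-alt xs (λ y ys → l y (x ∷ ys))))

  alt-lin : ∀ xs → Lin {ℕ × List ℕ} (λ Φ → alt (λ y ys → Φ (y , ys)) xs)
  alt-lin xs = lin-alt xs (λ y ys → lin-eval (y , ys))

  alt-cong : ∀ xs {f g : ℕ → List ℕ → Carrier} → (∀ y ys → f y ys ≈ g y ys) → alt f xs ≈ alt g xs
  alt-cong xs e = lin-cong (alt-lin xs) (λ p → e (proj₁ p) (proj₂ p))

  alt-+ : ∀ xs (f g : ℕ → List ℕ → Carrier) → alt (λ y ys → f y ys + g y ys) xs ≈ alt f xs + alt g xs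
  alt-+ xs f g = lin-add (alt-lin xs) (λ p → f (proj₁ p) (proj₂ p)) (λ p → g (proj₁ p) (proj₂ p))

  alt-* : ∀ xs r (f : ℕ → List ℕ → Carrier) → alt (λ y ys → r * f y ys) xs ≈ r * alt f xs
  alt-* xs r f = lin-scale (alt-lin xs) r (λ p → f (proj₁ p) (proj₂ p))

  alt-0 : ∀ xs {f : ℕ → List ℕ → Carrier} → (∀ y ys → f y ys ≈ 0#) → alt f xs ≈ 0#
  alt-0 xs e = lin-zero (alt-lin xs) (λ p → e (proj₁ p) (proj₂ p))

  -- The Leibniz sum over positions: with `pred` it becomes the sum over the rows of λ, with `suc`
  -- the sum over the rows of μ.
  bump : (ℕ → ℕ) → (ℕ → Carrier) → (List ℕ → Carrier) → List ℕ → Carrier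
  bump g w Φ []       = 0#
  bump g w Φ (x ∷ xs) = w x * Φ (g x ∷ xs) + bump g w (λ ys → Φ (x ∷ ys)) xs

  lin-bump : ∀ {A : Set} g w xs {T : List ℕ → (A → Carrier) → Carrier} →
             (∀ ys → Lin (T ys)) → Lin (λ Φ → bump g w (λ ys → T ys Φ) xs)
  lin-bump g w []       l = lin-0
  lin-bump g w (x ∷ xs) l = lin-+ (lin-* (w x) (l (g x ∷ xs))) (lin-bump g w xs (λ ys → l (x ∷ ys)))

  bump-lin : ∀ g w xs → Lin (λ Φ → bump g w Φ xs)
  bump-lin g w xs = lin-bump g w xs lin-eval

  -- The altered entry is either the one singled out or one of the rest; altering a value moves no
  -- position, so the signs are unaffected.
  bump-alt : ∀ g w (f : ℕ → List ℕ → Carrier) xs →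
    bump g w (alt f) xs ≈ alt (λ y ys → w y * f (g y) ys + bump g w (f y) ys) xs
  bump-alt g w f []       = refl
  bump-alt g w f (x ∷ xs) = begin
    w x * (f (g x) xs + - 1# * A) + bump g w (λ ys → f x ys + - 1# * alt f′ ys) xs
      ≈⟨ +-congˡ (lin-add (bump-lin g w xs) (f x) (λ ys → - 1# * alt f′ ys)) ⟩
    w x * (f (g x) xs + - 1# * A) + (B + bump g w (λ ys → - 1# * alt f′ ys) xs)
      ≈⟨ +-congˡ (+-congˡ (trans (lin-scale (bump-lin g w xs) (- 1#) (alt f′)) (*-congˡ (bump-alt g w f′ xs)))) ⟩
    w x * (f (g x) xs + - 1# * A) + (B + - 1# * E)
      ≈⟨ solve 6 (λ w p n a b e → w :* (p :+ n :* a) :+ (b :+ n :* e) := (w :* p :+ b) :+ n :* (e :+ w :* a))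
           refl (w x) (f (g x) xs) (- 1#) A B E ⟩
    (w x * f (g x) xs + B) + - 1# * (E + w x * A)
      ≈⟨ +-congˡ (*-congˡ (+-congˡ (sym (alt-* xs (w x) _)))) ⟩
    (w x * f (g x) xs + B) + - 1# * (E + alt (λ y ys → w x * f y (g x ∷ ys)) xs)
      ≈⟨ +-congˡ (*-congˡ (sym (alt-+ xs _ (λ y ys → w x * f y (g x ∷ ys))))) ⟩
    (w x * f (g x) xs + B) + - 1# * alt (λ y ys → (w y * f′ (g y) ys + bump g w (f′ y) ys) + w x * f y (g x ∷ ys)) xs
      ≈⟨ +-congˡ (*-congˡ (alt-cong xs (λ y ys →
           solve 3 (λ u v w → (u :+ v) :+ w := u :+ (w :+ v)) refl _ (bump g w (f′ y) ys) (w x * f y (g x ∷ ys))))) ⟩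
    (w x * f (g x) xs + B) + - 1# * alt (λ y ys → w y * f′ (g y) ys + (w x * f y (g x ∷ ys) + bump g w (f′ y) ys)) xs ∎
    where
    f′ : ℕ → List ℕ → Carrier
    f′ y ys = f y (x ∷ ys)
    A = alt (λ y ys → f y (g x ∷ ys)) xs
    B = bump g w (f x) xs
    E = alt (λ y ys → w y * f′ (g y) ys + bump g w (f′ y) ys) xs

  -- The Jacobi–Trudi determinant det (h_{ℓᵢ - mⱼ}), expanded along the first row.
  J : List ℕ → List ℕ → Series
  J []       []      = h 0
  J []       (_ ∷ _) = zeroS
  J (l ∷ ls) ms      = altS (λ m ms′ → hh l m ⊛ J ls ms′) ms

  J-at : ∀ l ls ms α → J (l ∷ ls) ms α ≈ alt (λ m ms′ → (hh l m ⊛ J ls ms′) α) ms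
  J-at l ls ms α = reflexive (altS-at (λ m ms′ → hh l m ⊛ J ls ms′) ms α)

  Λ-altS : ∀ xs {f : ℕ → List ℕ → Series} → (∀ y ys → IsΛ (f y ys)) → IsΛ (altS f xs)
  Λ-altS []       l = Λ-zero
  Λ-altS (x ∷ xs) l = Λ-⊕ (l x xs) (Λ-· (- 1#) (Λ-altS xs (λ y ys → l y (x ∷ ys))))

  Λ-J : ∀ ls ms → IsΛ (J ls ms)
  Λ-J []       []      = Λ-hh 0 0
  Λ-J []       (_ ∷ _) = Λ-zero
  Λ-J (l ∷ ls) ms      = Λ-altS ms (λ m ms′ → Λ-⊛ (Λ-hh l m) (Λ-J ls ms′))

  natR-+ : ∀ m n → natR (m ℕ.+ n) ≈ natR m + natR n
  natR-+ zero    n = sym (+-identityˡ _)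
  natR-+ (suc m) n = trans (+-congˡ (natR-+ m n)) (sym (+-assoc _ _ _))

  x+x≈x⇒x≈0 : ∀ {x} → x ≈ x + x → x ≈ 0#
  x+x≈x⇒x≈0 {x} e = begin
    x               ≈⟨ +-identityʳ x ⟨
    x + 0#          ≈⟨ +-congˡ (-‿inverseʳ x) ⟨
    x + (x + - x)   ≈⟨ +-assoc x x (- x) ⟨
    (x + x) + - x   ≈⟨ +-congʳ e ⟨
    x + - x         ≈⟨ -‿inverseʳ x ⟩
    0# ∎

  module Nabla {q a b : Carrier} (ab : a + b ≈ q + - 1#) {D : Series → Series} (nabla : IsNabla q D) (C : Carrier) where
    open IsNabla nabla

    -- The parts below are shifted: l = λᵢ - i + C.
    wA wB : ℕ → Carrier
    wA l = (natR l + - C) + a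
    wB m = b + - (natR m + - C)

    D-zero : D zeroS ≋ zeroS
    D-zero α = begin
      D zeroS α          ≈⟨ cong zeroS (0# · zeroS) Λ-zero (Λ-· 0# Λ-zero) (λ _ → sym (zeroˡ _)) α ⟩
      D (0# · zeroS) α   ≈⟨ homog 0# zeroS Λ-zero α ⟩
      0# * D zeroS α     ≈⟨ zeroˡ _ ⟩
      0# ∎

    D-h0 : D (h 0) ≋ zeroS
    D-h0 α = x+x≈x⇒x≈0 (begin
      D (h 0) α              ≈⟨ cong (h 0) (h 0 ⊛ h 0) Λh Λhh (λ β → sym (h0-⊛ (h 0) β)) α ⟩
      D (h 0 ⊛ h 0) α        ≈⟨ leibniz (h 0) (h 0) Λh Λh α ⟩
      (D (h 0) ⊛ h 0) α + (h 0 ⊛ D (h 0)) α ≈⟨ +-cong (⊛-h0 (D (h 0)) α) (h0-⊛ (D (h 0)) α) ⟩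
      D (h 0) α + D (h 0) α ∎)
      where
      Λh = Λ-hh 0 0
      Λhh = Λ-⊛ Λh Λh

    -- The offset `C` cancels between the row weight and the column weight, so it can be chosen to
    -- suit the shift of the parts.
    weights : ∀ m n → natR n + q + - 1# ≈ wA (m ℕ.+ n) + wB m
    weights m n = sym (begin
      ((natR (m ℕ.+ n) + - C) + a) + (b + - (natR m + - C))
        ≈⟨ +-cong (+-congʳ (+-congʳ (natR-+ m n))) (+-congˡ (sym (⁻¹-∙-comm (natR m) (- C)))) ⟩
      (((natR m + natR n) + - C) + a) + (b + (- natR m + - - C))
        ≈⟨ solve 7 (λ m n c a b m′ c′ → (((m :+ n) :+ c) :+ a) :+ (b :+ (m′ :+ c′))
                                    := (n :+ (a :+ b)) :+ ((m :+ m′) :+ (c :+ c′)))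
             refl (natR m) (natR n) (- C) a b (- natR m) (- - C) ⟩
      (natR n + (a + b)) + ((natR m + - natR m) + (- C + - - C))
        ≈⟨ +-cong (+-congˡ ab) (trans (+-cong (-‿inverseʳ _) (-‿inverseʳ _)) (+-identityˡ _)) ⟩
      (natR n + (q + - 1#)) + 0#
        ≈⟨ trans (+-identityʳ _) (sym (+-assoc _ _ _)) ⟩
      natR n + q + - 1# ∎)

    -- For m > l the right side contains an h of negative index and is zero whatever the weight,
    -- matching the derivative of h₀ = 1 or of 0.
    D-hh : ∀ l m → D (hh (suc l) m) ≋ ((wA (suc l) + wB m) · hh l m)
    D-hh l m α with ℕₚ.<-cmp m (suc l)
    ... | tri< (s≤s m≤l) _ _ = begin
      D (hh (suc l) m) α
        ≈⟨ cong _ (h (suc n)) (Λ-hh (suc l) m) (Λ-hh (suc n) 0)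
             (λ β → trans (reflexive (≡.cong (λ z → hh z m β) sl≡)) (hh-h m (suc n) β)) α ⟩
      D (h (suc n)) α
        ≈⟨ onH n α ⟩
      (natR (suc n) + q + - 1#) * h n α
        ≈⟨ *-cong (trans (weights m (suc n)) (reflexive (≡.cong (λ z → wA z + wB m) (≡.sym sl≡))))
             (trans (sym (hh-h m n α)) (reflexive (≡.cong (λ z → hh z m α) (ℕₚ.m+[n∸m]≡n m≤l)))) ⟩
      (wA (suc l) + wB m) * hh l m α ∎
      where
      n = l ∸ m
      sl≡ : suc l ≡ m ℕ.+ suc n
      sl≡ = ≡.sym (≡.trans (ℕₚ.+-suc m n) (≡.cong suc (ℕₚ.m+[n∸m]≡n m≤l)))
    ... | tri≈ _ ≡.refl _ = begin
      D (hh (suc l) (suc l)) α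
        ≈⟨ cong _ (h 0) (Λ-hh (suc l) (suc l)) (Λ-hh 0 0)
             (λ β → trans (reflexive (≡.cong (λ z → hh z (suc l) β) (≡.sym (ℕₚ.+-identityʳ (suc l)))))
                          (hh-h (suc l) 0 β)) α ⟩
      D (h 0) α  ≈⟨ D-h0 α ⟩
      0#         ≈⟨ zeroʳ _ ⟨
      (wA (suc l) + wB (suc l)) * 0# ≈⟨ *-congˡ (hh-zero (ℕₚ.n<1+n l) α) ⟨
      (wA (suc l) + wB (suc l)) * hh l (suc l) α ∎
    ... | tri> _ _ sl<m = begin
      D (hh (suc l) m) α ≈⟨ cong _ zeroS (Λ-hh (suc l) m) Λ-zero (hh-zero sl<m) α ⟩
      D zeroS α  ≈⟨ D-zero α ⟩
      0#         ≈⟨ zeroʳ _ ⟨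
      (wA (suc l) + wB m) * 0# ≈⟨ *-congˡ (hh-zero (ℕₚ.<-trans (ℕₚ.n<1+n l) sl<m) α) ⟨
      (wA (suc l) + wB m) * hh l m α ∎

    D-altS : ∀ xs {f : ℕ → List ℕ → Series} → (∀ y ys → IsΛ (f y ys)) →
             D (altS f xs) ≋ altS (λ y ys → D (f y ys)) xs
    D-altS []       l α = D-zero α
    D-altS (x ∷ xs) {f} l α = begin
      D (f x xs ⊕ ((- 1#) · altS f′ xs)) α
        ≈⟨ additive (f x xs) _ (l x xs) (Λ-· (- 1#) Λ′) α ⟩
      D (f x xs) α + D ((- 1#) · altS f′ xs) α
        ≈⟨ +-congˡ (homog (- 1#) (altS f′ xs) Λ′ α) ⟩
      D (f x xs) α + - 1# * D (altS f′ xs) α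
        ≈⟨ +-congˡ (*-congˡ (D-altS xs (λ y ys → l y (x ∷ ys)) α)) ⟩
      D (f x xs) α + - 1# * altS (λ y ys → D (f′ y ys)) xs α ∎
      where
      f′ : ℕ → List ℕ → Series
      f′ y ys = f y (x ∷ ys)
      Λ′ = Λ-altS xs (λ y ys → l y (x ∷ ys))

    -- Leibniz is applied to an entry of the first row times its minor. The weight of the row is the
    -- same for all its entries and leaves the alternating sum; the weight of the column joins the
    -- bumps inside the minor by `bump-alt`. Positivity makes `pred` a genuine decrement.
    D-J : ∀ ls ms → All (0 ℕ.<_) ls → ∀ α →
          D (J ls ms) α ≈ bump pred wA (λ ls′ → J ls′ ms α) ls + bump suc wB (λ ns → J ls ns α) ms
    D-J []       []       _ α = trans (D-h0 α) (sym (+-identityˡ _))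
    D-J []       (m ∷ ms) _ α = trans (D-zero α) (sym (trans (+-identityˡ _)
      (trans (+-cong (zeroʳ _) (lin-zero (bump-lin suc wB ms) (λ _ → refl))) (+-identityˡ _))))
    D-J (suc l ∷ ls) ms (_ ∷ pos) α = begin
      D (J (suc l ∷ ls) ms) α
        ≈⟨ D-altS ms (λ m ms′ → Λ-⊛ (Λ-hh (suc l) m) (Λ-J ls ms′)) α ⟩
      altS (λ m ms′ → D (hh (suc l) m ⊛ J ls ms′)) ms α
        ≈⟨ reflexive (altS-at (λ m ms′ → D (hh (suc l) m ⊛ J ls ms′)) ms α) ⟩
      alt (λ m ms′ → D (hh (suc l) m ⊛ J ls ms′) α) ms
        ≈⟨ alt-cong ms step ⟩
      alt (λ m ms′ → (wA (suc l) * F m ms′ + P m ms′) + Q m ms′) ms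
        ≈⟨ trans (alt-+ ms (λ m ms′ → wA (suc l) * F m ms′ + P m ms′) Q)
             (+-congʳ (alt-+ ms (λ m ms′ → wA (suc l) * F m ms′) P)) ⟩
      (alt (λ m ms′ → wA (suc l) * F m ms′) ms + alt P ms) + alt Q ms
        ≈⟨ +-cong (+-cong first second) third ⟩
      (wA (suc l) * J (l ∷ ls) ms α + bump pred wA (λ ls′ → J (suc l ∷ ls′) ms α) ls)
        + bump suc wB (λ ns → J (suc l ∷ ls) ns α) ms ∎
      where
      F P Q : ℕ → List ℕ → Carrier
      F m ms′ = (hh l m ⊛ J ls ms′) α
      P m ms′ = bump pred wA (λ ls′ → (hh (suc l) m ⊛ J ls′ ms′) α) ls
      Q m ms′ = wB m * F m ms′ + bump suc wB (λ ns → (hh (suc l) m ⊛ J ls ns) α) ms′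

      step : ∀ m ms′ → D (hh (suc l) m ⊛ J ls ms′) α ≈ (wA (suc l) * F m ms′ + P m ms′) + Q m ms′
      step m ms′ = begin
        D (hh (suc l) m ⊛ J ls ms′) α
          ≈⟨ leibniz (hh (suc l) m) (J ls ms′) (Λ-hh (suc l) m) (Λ-J ls ms′) α ⟩
        (D (hh (suc l) m) ⊛ J ls ms′) α + (hh (suc l) m ⊛ D (J ls ms′)) α
          ≈⟨ +-cong (trans (⊛-congˡ (J ls ms′) (D-hh l m) α) (⊛-·ˡ _ (hh l m) (J ls ms′) α))
                    (trans (⊛-congʳ (hh (suc l) m) (D-J ls ms′ pos) α)
                      (lin-add (lin-⊛ʳ (hh (suc l) m) α) (λ β → bump pred wA (λ ls′ → J ls′ ms′ β) ls)
                               (λ β → bump suc wB (λ ns → J ls ns β) ms′))) ⟩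
        (wA (suc l) + wB m) * F m ms′ +
          ((hh (suc l) m ⊛ (λ β → bump pred wA (λ ls′ → J ls′ ms′ β) ls)) α +
           (hh (suc l) m ⊛ (λ β → bump suc wB (λ ns → J ls ns β) ms′)) α)
          ≈⟨ +-congˡ (+-cong
               (lin-swap (lin-⊛ʳ (hh (suc l) m) α) (bump-lin pred wA ls) (λ β ls′ → J ls′ ms′ β))
               (lin-swap (lin-⊛ʳ (hh (suc l) m) α) (bump-lin suc wB ms′) (λ β ns → J ls ns β))) ⟩
        (wA (suc l) + wB m) * F m ms′ + (P m ms′ + bump suc wB (λ ns → (hh (suc l) m ⊛ J ls ns) α) ms′)
          ≈⟨ solve 5 (λ u v f p s → (u :+ v) :* f :+ (p :+ s) := (u :* f :+ p) :+ (v :* f :+ s)) refl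
               (wA (suc l)) (wB m) (F m ms′) (P m ms′) _ ⟩
        (wA (suc l) * F m ms′ + P m ms′) + Q m ms′ ∎

      first : alt (λ m ms′ → wA (suc l) * F m ms′) ms ≈ wA (suc l) * J (l ∷ ls) ms α
      first = trans (alt-* ms (wA (suc l)) F) (*-congˡ (sym (J-at l ls ms α)))

      second : alt P ms ≈ bump pred wA (λ ls′ → J (suc l ∷ ls′) ms α) ls
      second = begin
        alt P ms
          ≈⟨ lin-swap (alt-lin ms) (bump-lin pred wA ls) (λ p ls′ → (hh (suc l) (proj₁ p) ⊛ J ls′ (proj₂ p)) α) ⟩
        bump pred wA (λ ls′ → alt (λ m ms′ → (hh (suc l) m ⊛ J ls′ ms′) α) ms) ls
          ≈⟨ lin-cong (bump-lin pred wA ls) (λ ls′ → sym (J-at (suc l) ls′ ms α)) ⟩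
        bump pred wA (λ ls′ → J (suc l ∷ ls′) ms α) ls ∎

      third : alt Q ms ≈ bump suc wB (λ ns → J (suc l ∷ ls) ns α) ms
      third = begin
        alt Q ms
          ≈⟨ bump-alt suc wB (λ m ms′ → (hh (suc l) m ⊛ J ls ms′) α) ms ⟨
        bump suc wB (alt (λ m ms′ → (hh (suc l) m ⊛ J ls ms′) α)) ms
          ≈⟨ lin-cong (bump-lin suc wB ms) (λ ns → sym (J-at (suc l) ls ns α)) ⟩
        bump suc wB (λ ns → J (suc l ∷ ls) ns α) ms ∎

  -- Expanding the determinant in one variable

  lin-∘ : {A B : Set} {T : (A → Carrier) → Carrier} → Lin T → (g : A → B) → Lin (λ Φ → T (λ x → Φ (g x)))
  lin-∘ (mkLin t et) g = mkLin (map (λ p → proj₁ p , g (proj₂ p)) t) λ Φ →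
    trans (et _) (sym (ΣL-map t _))

  -- The sum of Φ (m + κ) over all κ of total `k`, free of the interlacing condition that defines
  -- horizontal strips.
  Free : List ℕ → ℕ → (List ℕ → Carrier) → Carrier
  Free []       k Φ = ind (k ≡ᵇ 0) * Φ []
  Free (m ∷ ms) k Φ = conv k (λ j r → Free ms r (λ ns → Φ (m ℕ.+ j ∷ ns)))

  lin-Free : ∀ ms k → Lin (Free ms k)
  lin-Free []       k = lin-* (ind (k ≡ᵇ 0)) (lin-eval [])
  lin-Free (m ∷ ms) k = lin-conv k (λ j r → lin-∘ (lin-Free ms r) (m ℕ.+ j ∷_))

  -- Distributing `k` over the columns commutes with singling out a column: `conv-exchange` brings
  -- the share of the chosen column in front of the share of a column passed over.
  Free-alt : ∀ ms k (f : ℕ → List ℕ → Carrier) →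
    Free ms k (alt f) ≈ alt (λ m ms′ → conv k (λ j r → Free ms′ r (f (m ℕ.+ j)))) ms
  Free-alt []       k f = zeroʳ _
  Free-alt (x ∷ xs) k f = begin
    conv k (λ j r → Free xs r (λ ns → f (x ℕ.+ j) ns + - 1# * alt (f′ j) ns))
      ≈⟨ conv-cong k (λ j r → trans (lin-add (lin-Free xs r) (f (x ℕ.+ j)) (λ ns → - 1# * alt (f′ j) ns))
           (+-congˡ (trans (lin-scale (lin-Free xs r) (- 1#) (alt (f′ j))) (*-congˡ (Free-alt xs r (f′ j)))))) ⟩
    conv k (λ j r → Free xs r (f (x ℕ.+ j)) + - 1# * alt (G j r) xs)
      ≈⟨ trans (conv-+ k (λ j r → Free xs r (f (x ℕ.+ j))) (λ j r → - 1# * alt (G j r) xs))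
           (+-congˡ (conv-* k (- 1#) (λ j r → alt (G j r) xs))) ⟩
    head′ + - 1# * conv k (λ j r → alt (G j r) xs)
      ≈⟨ +-congˡ (*-congˡ (lin-swap (conv-lin k) (alt-lin xs)
           (λ p p′ → G (proj₁ p) (proj₂ p) (proj₁ p′) (proj₂ p′)))) ⟩
    head′ + - 1# * alt (λ y ys → conv k (λ j r → G j r y ys)) xs
      ≈⟨ +-congˡ (*-congˡ (alt-cong xs (λ y ys →
           conv-exchange k (λ j i s → Free ys s (λ ns → f (y ℕ.+ i) (x ℕ.+ j ∷ ns)))))) ⟩
    head′ + - 1# * alt (λ y ys → conv k (λ i r → Free (x ∷ ys) r (f (y ℕ.+ i)))) xs ∎
    where
    f′ : ℕ → ℕ → List ℕ → Carrier
    f′ j y ys = f y (x ℕ.+ j ∷ ys)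
    G : ℕ → ℕ → ℕ → List ℕ → Carrier
    G j r y ys = conv r (λ i s → Free ys s (f′ j (y ℕ.+ i)))
    head′ = conv k (λ j r → Free xs r (f (x ℕ.+ j)))

  -- Extracting x₁ʲ from h_{ℓ-m} leaves h_{ℓ-m-j} in the other variables, which amounts to raising m
  -- by j. Each term of the determinant uses every column exactly once, so the exponents can be
  -- indexed by columns.
  J-∷ : ∀ ls ms k α → J ls ms (k ∷ α) ≈ Free ms k (λ ns → J ls ns α)
  J-∷ [] [] zero    α = sym (*-identityˡ _)
  J-∷ [] [] (suc k) α = sym (zeroˡ _)
  J-∷ [] (m ∷ ms) k α = sym (conv-0 k (λ j r → lin-zero (lin-Free ms r) (λ _ → refl)))
  J-∷ (l ∷ ls) ms k α = begin
    J (l ∷ ls) ms (k ∷ α)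
      ≈⟨ J-at l ls ms (k ∷ α) ⟩
    alt (λ m ms′ → (hh l m ⊛ J ls ms′) (k ∷ α)) ms
      ≈⟨ alt-cong ms step ⟩
    alt (λ m ms′ → conv k (λ j r → Free ms′ r (λ ns → (hh l (m ℕ.+ j) ⊛ J ls ns) α))) ms
      ≈⟨ Free-alt ms k (λ m ms′ → (hh l m ⊛ J ls ms′) α) ⟨
    Free ms k (alt (λ m ms′ → (hh l m ⊛ J ls ms′) α))
      ≈⟨ lin-cong (lin-Free ms k) (λ ns → sym (J-at l ls ns α)) ⟩
    Free ms k (λ ns → J (l ∷ ls) ns α) ∎
    where
    step : ∀ m ms′ → (hh l m ⊛ J ls ms′) (k ∷ α) ≈
                     conv k (λ j r → Free ms′ r (λ ns → (hh l (m ℕ.+ j) ⊛ J ls ns) α))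
    step m ms′ = trans (⊛-∷ (hh l m) (J ls ms′) k α) (conv-cong k λ j r → begin
      (slice (hh l m) j ⊛ slice (J ls ms′) r) α
        ≈⟨ ⊛-congˡ (slice (J ls ms′) r) (hh-slice l m j) α ⟩
      (hh l (m ℕ.+ j) ⊛ slice (J ls ms′) r) α
        ≈⟨ ⊛-congʳ (hh l (m ℕ.+ j)) (J-∷ ls ms′ r) α ⟩
      (hh l (m ℕ.+ j) ⊛ (λ β → Free ms′ r (λ ns → J ls ns β))) α
        ≈⟨ lin-swap (lin-⊛ʳ (hh l (m ℕ.+ j)) α) (lin-Free ms′ r) (λ β ns → J ls ns β) ⟩
      Free ms′ r (λ ns → (hh l (m ℕ.+ j) ⊛ J ls ns) α) ∎)

  -- Alternating functions and the cancellation down to horizontal strips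

  data AdjSwap : List ℕ → List ℕ → Set where
    here  : ∀ {y z zs} → AdjSwap (y ∷ z ∷ zs) (z ∷ y ∷ zs)
    there : ∀ {x ys zs} → AdjSwap ys zs → AdjSwap (x ∷ ys) (x ∷ zs)

  data AdjEqual : List ℕ → Set where
    here  : ∀ {y zs} → AdjEqual (y ∷ y ∷ zs)
    there : ∀ {x ys} → AdjEqual ys → AdjEqual (x ∷ ys)

  -- Vanishing on repeated entries is a separate field since antisymmetry yields only 2Φ = 0.
  -- Adjacent positions suffice for the cancellation below.
  record Alternating (Φ : List ℕ → Carrier) : Set (c ⊔ ℓ) where
    constructor mkAlternating
    field
      antisym  : ∀ {ms ns} → AdjSwap ms ns → Φ ms + Φ ns ≈ 0#
      vanishes : ∀ {ms} → AdjEqual ms → Φ ms ≈ 0#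
  open Alternating

  Alternating-∷ : ∀ {Φ} x → Alternating Φ → Alternating (λ ns → Φ (x ∷ ns))
  Alternating-∷ x a = mkAlternating (λ s → antisym a (there s)) (λ e → vanishes a (there e))

  x+-1x≈0 : ∀ x → x + - 1# * x ≈ 0#
  x+-1x≈0 x = trans (+-congˡ (-1*x≈-x x)) (-‿inverseʳ x)

  -- Terms singling out one of the two adjacent entries cancel because these positions carry
  -- opposite signs; in all other terms both entries lie in the minor, where `f y` is alternating.
  alternating-alt : ∀ f → (∀ y → Alternating (f y)) → Alternating (alt f)
  alternating-alt f a = mkAlternating (sw f a) (eq f a)
    where
    sw : ∀ f → (∀ y → Alternating (f y)) → ∀ {ms ns} → AdjSwap ms ns → alt f ms + alt f ns ≈ 0#
    sw f a (here {y} {z} {zs}) = begin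
      (p + - 1# * (r + - 1# * A)) + (r + - 1# * (p + - 1# * B))
        ≈⟨ solve 5 (λ n p r a b → (p :+ n :* (r :+ n :* a)) :+ (r :+ n :* (p :+ n :* b)) :=
                                ((p :+ n :* p) :+ (r :+ n :* r)) :+ n :* (n :* (a :+ b))) refl (- 1#) p r A B ⟩
      ((p + - 1# * p) + (r + - 1# * r)) + - 1# * (- 1# * (A + B))
        ≈⟨ +-cong (trans (+-cong (x+-1x≈0 p) (x+-1x≈0 r)) (+-identityˡ _))
             (*-congˡ (*-congˡ (trans (sym (alt-+ zs (λ w ws → f w (y ∷ z ∷ ws)) (λ w ws → f w (z ∷ y ∷ ws))))
                                      (alt-0 zs (λ w ws → antisym (a w) here))))) ⟩
      0# + - 1# * (- 1# * 0#)
        ≈⟨ trans (+-identityˡ _) (trans (*-congˡ (zeroʳ _)) (zeroʳ _)) ⟩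
      0# ∎
      where
      p = f y (z ∷ zs)
      r = f z (y ∷ zs)
      A = alt (λ w ws → f w (y ∷ z ∷ ws)) zs
      B = alt (λ w ws → f w (z ∷ y ∷ ws)) zs
    sw f a (there {x} {ys} {zs} s) = begin
      (f x ys + - 1# * A) + (f x zs + - 1# * B)
        ≈⟨ solve 5 (λ n p r a b → (p :+ n :* a) :+ (r :+ n :* b) := (p :+ r) :+ n :* (a :+ b)) refl
             (- 1#) (f x ys) (f x zs) A B ⟩
      (f x ys + f x zs) + - 1# * (A + B)
        ≈⟨ +-cong (antisym (a x) s) (*-congˡ (sw (λ y ws → f y (x ∷ ws)) (λ y → Alternating-∷ x (a y)) s)) ⟩
      0# + - 1# * 0#
        ≈⟨ trans (+-identityˡ _) (zeroʳ _) ⟩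
      0# ∎
      where
      A = alt (λ w ws → f w (x ∷ ws)) ys
      B = alt (λ w ws → f w (x ∷ ws)) zs
    eq : ∀ f → (∀ y → Alternating (f y)) → ∀ {ms} → AdjEqual ms → alt f ms ≈ 0#
    eq f a (here {y} {zs}) = begin
      p + - 1# * (p + - 1# * A)
        ≈⟨ solve 3 (λ n p a → p :+ n :* (p :+ n :* a) := (p :+ n :* p) :+ n :* (n :* a)) refl (- 1#) p A ⟩
      (p + - 1# * p) + - 1# * (- 1# * A)
        ≈⟨ +-cong (x+-1x≈0 p) (*-congˡ (*-congˡ (alt-0 zs (λ w ws → vanishes (a w) here)))) ⟩
      0# + - 1# * (- 1# * 0#)
        ≈⟨ trans (+-identityˡ _) (trans (*-congˡ (zeroʳ _)) (zeroʳ _)) ⟩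
      0# ∎
      where
      p = f y (y ∷ zs)
      A = alt (λ w ws → f w (y ∷ y ∷ ws)) zs
    eq f a (there {x} {ys} e) = trans
      (+-cong (vanishes (a x) e) (*-congˡ (eq (λ y ws → f y (x ∷ ws)) (λ y → Alternating-∷ x (a y)) e)))
      (trans (+-identityˡ _) (zeroʳ _))

  J-alternating : ∀ ls α → Alternating (λ ms → J ls ms α)
  J-alternating []       α = mkAlternating (λ { here → +-identityˡ _ ; (there _) → +-identityˡ _ })
                                           (λ { here → refl ; (there _) → refl })
  J-alternating (l ∷ ls) α = mkAlternating
    (λ {ms} {ns} s → trans (+-cong (J-at l ls ms α) (J-at l ls ns α)) (antisym alternating s))
    (λ {ms} e → trans (J-at l ls ms α) (vanishes alternating e))
    where
    alternating : Alternating (alt (λ m ms′ → (hh l m ⊛ J ls ms′) α))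
    alternating = alternating-alt _ λ m → mkAlternating
      (λ {ms} {ns} s → trans (sym (lin-add (lin-⊛ʳ (hh l m) α) (J ls ms) (J ls ns)))
        (⊛-zeroʳ (hh l m) α (λ β → antisym (J-alternating ls β) s)))
      (λ e → ⊛-zeroʳ (hh l m) α (λ β → vanishes (J-alternating ls β) e))

  -- Sum over the sequences ns ≥ ms of total excess k with nᵢ₊₁ ◁ mᵢ (and n₁ ◁ p): these are the
  -- horizontal strips, with ◁ the relation ≤ for partitions and < for the shifted parts μᵢ - i.
  module Strip (_◁_ : ℕ → ℕ → Bool) where

    strips : ℕ → List ℕ → ℕ → (List ℕ → Carrier) → Carrier
    strips p []       k Φ = ind (k ≡ᵇ 0) * Φ []
    strips p (m ∷ ms) k Φ = conv k (λ j r → ind ((m ℕ.+ j) ◁ p) * strips m ms r (λ ns → Φ (m ℕ.+ j ∷ ns)))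

    lin-strips : ∀ p ms k → Lin (strips p ms k)
    lin-strips p []       k = lin-* (ind (k ≡ᵇ 0)) (lin-eval [])
    lin-strips p (m ∷ ms) k = lin-conv k (λ j r → lin-* _ (lin-∘ (lin-strips m ms r) (m ℕ.+ j ∷_)))

    module _ {_≻_ : ℕ → ℕ → Set} (sound : ∀ n p → (n ◁ p) ≡ true → p ≻ n)
             (mono : ∀ {n p x} → n ℕ.≤ p → n ≻ x → p ≻ x) where

      -- The facts supplied about `ns` are those that let an induction on the exponent list continue
      -- with `ns` in place of `ms`.
      strips-cong : ∀ p ms k {Φ Ψ : List ℕ → Carrier} →
        (∀ ns → Linked _≻_ (p ∷ ns) → length ns ≡ length ms → (All (0 ℕ.<_) ms → All (0 ℕ.<_) ns) → Φ ns ≈ Ψ ns) →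
        strips p ms k Φ ≈ strips p ms k Ψ
      strips-cong p []       k e = *-congˡ (e [] [-] ≡.refl id)
      strips-cong p (m ∷ ms) k {Φ} {Ψ} e = conv-cong k step
        where
        step : ∀ j r → ind ((m ℕ.+ j) ◁ p) * strips m ms r (λ ns → Φ (m ℕ.+ j ∷ ns)) ≈
                       ind ((m ℕ.+ j) ◁ p) * strips m ms r (λ ns → Ψ (m ℕ.+ j ∷ ns))
        step j r with (m ℕ.+ j) ◁ p in eq
        ... | false = trans (zeroˡ _) (sym (zeroˡ _))
        ... | true  = *-congˡ (strips-cong m ms r λ ns lk len pos →
                        e (m ℕ.+ j ∷ ns) (sound _ p eq ∷ raise lk) (≡.cong suc len)
                          (λ { (q ∷ qs) → ℕₚ.<-≤-trans q (ℕₚ.m≤m+n m j) ∷ pos qs }))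
          where
          -- The strip condition bounds the next entry by the old `m`, hence also by the new entry m
          -- + j.
          raise : ∀ {ns} → Linked _≻_ (m ∷ ns) → Linked _≻_ (m ℕ.+ j ∷ ns)
          raise [-]      = [-]
          raise (q ∷ lk) = mono (ℕₚ.m≤m+n m j) q ∷ lk

  <ᵇ-∸ : ∀ {m n} j → m ℕ.≤ n → (j <ᵇ n ∸ m) ≡ (m ℕ.+ j <ᵇ n)
  <ᵇ-∸ j z≤n     = ≡.refl
  <ᵇ-∸ j (s≤s p) = <ᵇ-∸ j p

  module < = Strip _<ᵇ_

  strips<-cong : ∀ p ms k {Φ Ψ : List ℕ → Carrier} →
    (∀ ns → Linked ℕ._>_ (p ∷ ns) → length ns ≡ length ms → (All (0 ℕ.<_) ms → All (0 ℕ.<_) ns) → Φ ns ≈ Ψ ns) →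
    <.strips p ms k Φ ≈ <.strips p ms k Ψ
  strips<-cong = <.strips-cong <ᵇ≡true⇒< (λ n≤p x<n → ℕₚ.<-≤-trans x<n n≤p)

  -- With d = m - m₂, exchanging the first two entries pairs (m + i, m₂ + d + j) with (m + j, m₂ + d
  -- + i), and the survivors have m₂ + j < m. The tail, already cut to strips by induction, is
  -- bounded by m₂ and not by the raised second entry, so the exchange leaves it alone. The first
  -- entry stays unbounded.
  Free-strips : ∀ m ms k {Φ} → Linked ℕ._>_ (m ∷ ms) → Alternating Φ →
    Free (m ∷ ms) k Φ ≈ conv k (λ j r → <.strips m ms r (λ ns → Φ (m ℕ.+ j ∷ ns)))
  Free-strips m []        k lk a = refl
  Free-strips m (m₂ ∷ ms) k {Φ} (m₂<m ∷ lk) a = begin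
    conv k (λ i r → Free (m₂ ∷ ms) r (λ ns → Φ (m ℕ.+ i ∷ ns)))
      ≈⟨ conv-cong k (λ i r → Free-strips m₂ ms r lk (Alternating-∷ (m ℕ.+ i) a)) ⟩
    conv k (λ i r → conv r (X i))
      ≈⟨ conv-cut d k X
           (λ i s → lin-zero (<.lin-strips m₂ ms s) (λ ns →
              trans (reflexive (≡.cong (λ z → Φ (m ℕ.+ i ∷ z ∷ ns)) (shift i))) (vanishes a here)))
           (λ i j s → trans (sym (lin-add (<.lin-strips m₂ ms s) (λ ns → Φ (m ℕ.+ i ∷ m₂ ℕ.+ (d ℕ.+ j) ∷ ns))
                                    (λ ns → Φ (m ℕ.+ j ∷ m₂ ℕ.+ (d ℕ.+ i) ∷ ns))))
              (lin-zero (<.lin-strips m₂ ms s) (λ ns → trans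
                (reflexive (≡.cong₂ (λ z z′ → Φ (m ℕ.+ i ∷ z ∷ ns) + Φ (m ℕ.+ j ∷ z′ ∷ ns)) (shift j) (shift i)))
                (antisym a here)))) ⟩
    conv k (λ i r → conv r (λ j s → ind (j <ᵇ d) * X i j s))
      ≈⟨ conv-cong k (λ i r → conv-cong r (λ j s → reflexive (≡.cong (λ z → ind z * X i j s) (<ᵇ-∸ j m₂≤m)))) ⟩
    conv k (λ i r → conv r (λ j s → ind (m₂ ℕ.+ j <ᵇ m) * X i j s)) ∎
    where
    m₂≤m = ℕₚ.<⇒≤ m₂<m
    d = m ∸ m₂
    X : ℕ → ℕ → ℕ → Carrier
    X i j s = <.strips m₂ ms s (λ ns → Φ (m ℕ.+ i ∷ m₂ ℕ.+ j ∷ ns))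
    shift : ∀ i → m₂ ℕ.+ (d ℕ.+ i) ≡ m ℕ.+ i
    shift i = ≡.trans (≡.sym (ℕₚ.+-assoc m₂ d i)) (≡.cong (ℕ._+ i) (ℕₚ.m+[n∸m]≡n m₂≤m))

  -- Constant term and vanishing of the determinant

  alt-any : ∀ {P : ℕ → Set} f {ms} → Any P ms → (∀ m ms′ → P m → f m ms′ ≈ 0#) →
    (∀ m ms′ → Any P ms′ → f m ms′ ≈ 0#) → alt f ms ≈ 0#
  alt-any f {m ∷ ms} (here p) e₁ e₂ = trans
    (+-cong (e₁ m ms p) (*-congˡ (alt-0 ms (λ y ys → e₂ y (m ∷ ys) (here p)))))
    (trans (+-identityˡ _) (zeroʳ _))
  alt-any f {m ∷ ms} (there p) e₁ e₂ = trans
    (+-cong (e₂ m ms p) (*-congˡ (alt-any (λ y ys → f y (m ∷ ys)) p (λ y ys → e₁ y (m ∷ ys))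
                                           (λ y ys q → e₂ y (m ∷ ys) (there q)))))
    (trans (+-identityˡ _) (zeroʳ _))

  alt-all : ∀ {P : ℕ → Set} f {ms} → All P ms → (∀ m ms′ → P m → f m ms′ ≈ 0#) → alt f ms ≈ 0#
  alt-all f []       e = refl
  alt-all f {m ∷ ms} (p ∷ ps) e = trans
    (+-cong (e m ms p) (*-congˡ (alt-all (λ y ys → f y (m ∷ ys)) ps (λ y ys → e y (m ∷ ys)))))
    (trans (+-identityˡ _) (zeroʳ _))

  -- The column of such an `m` consists of h's of negative index; it is either the column singled
  -- out or still present in the minor.
  J-zero-column : ∀ ls ms → Any (λ m → All (ℕ._< m) ls) ms → J ls ms ≋ zeroS
  J-zero-column []       (m ∷ ms) p α = refl
  J-zero-column (l ∷ ls) ms       p α = trans (J-at l ls ms α) (alt-any _ p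
    (λ m ms′ l<m → ⊛-zeroˡ (J ls ms′) α (hh-zero (All.head l<m)))
    (λ m ms′ q → ⊛-zeroʳ (hh l m) α (J-zero-column ls ms′ (Any.map All.tail q))))

  _≡ᴸ_ : List ℕ → List ℕ → Bool
  []       ≡ᴸ []       = true
  (x ∷ xs) ≡ᴸ (y ∷ ys) = (x ≡ᵇ y) ∧ (xs ≡ᴸ ys)
  _        ≡ᴸ _        = false

  ≡ᴸ⇒≡ : ∀ xs ys → (xs ≡ᴸ ys) ≡ true → xs ≡ ys
  ≡ᴸ⇒≡ []       []       e = ≡.refl
  ≡ᴸ⇒≡ (x ∷ xs) (y ∷ ys) e with x ≡ᵇ y in eq
  ... | true = ≡.cong₂ _∷_ (ℕₚ.≡ᵇ⇒≡ x y (≡.subst T (≡.sym eq) _)) (≡ᴸ⇒≡ xs ys e)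

  hh-[]-zero : ∀ {l m} → m ≢ l → hh l m [] ≈ 0#
  hh-[]-zero {l} {m} p = reflexive (≡.cong ind (≢⇒≡ᵇ-false _ _ (λ e → p (≡.trans (≡.sym (ℕₚ.+-identityʳ m)) e))))

  head≥ : ∀ {l ls} → Linked ℕ._≥_ (l ∷ ls) → All (ℕ._≤ l) (l ∷ ls)
  head≥ lk = Linked⇒All (λ p q → ℕₚ.≤-trans q p) ℕₚ.≤-refl lk

  head> : ∀ {m ms} → Linked ℕ._>_ (m ∷ ms) → All (ℕ._< m) ms
  head> [-]      = []
  head> (p ∷ lk) = Linked⇒All (λ p q → ℕₚ.<-trans q p) p lk

  -- In the constant term the matrix has entries 1 where ℓᵢ = mⱼ and 0 elsewhere. By monotonicity l
  -- < m kills the first column, l > m kills the first row, and l = m leaves only the corner in the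
  -- first row.
  J-[] : ∀ ls ms → Linked ℕ._≥_ ls → Linked ℕ._>_ ms → J ls ms [] ≈ ind (ls ≡ᴸ ms)
  J-[] []       []       lk lk′ = refl
  J-[] []       (m ∷ ms) lk lk′ = refl
  J-[] (l ∷ ls) []       lk lk′ = refl
  J-[] (l ∷ ls) (m ∷ ms) lk lk′ with ℕₚ.<-cmp l m
  ... | tri< l<m _ _ = trans
    (J-zero-column (l ∷ ls) (m ∷ ms) (here (All.map (λ x≤l → ℕₚ.≤-<-trans x≤l l<m) (head≥ lk))) [])
    (reflexive (≡.cong (λ z → ind (z ∧ (ls ≡ᴸ ms))) (≡.sym (≢⇒≡ᵇ-false l m (ℕₚ.<⇒≢ l<m)))))
  ... | tri≈ _ ≡.refl _ = begin
    J (l ∷ ls) (l ∷ ms) []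
      ≈⟨ J-at l ls (l ∷ ms) [] ⟩
    (hh l l ⊛ J ls ms) [] + - 1# * alt (λ y ys → (hh l y ⊛ J ls (l ∷ ys)) []) ms
      ≈⟨ +-cong (⊛-[] (hh l l) (J ls ms)) (*-congˡ (alt-all _ (head> lk′) (λ y ys y<l →
           trans (⊛-[] (hh l y) (J ls (l ∷ ys))) (trans (*-congʳ (hh-[]-zero (ℕₚ.<⇒≢ y<l))) (zeroˡ _))))) ⟩
    hh l l [] * J ls ms [] + - 1# * 0#
      ≈⟨ +-cong (*-cong (reflexive (≡.cong ind (≡.trans (≡.cong (_≡ᵇ l) (ℕₚ.+-identityʳ l)) (≡ᵇ-refl l))))
           (J-[] ls ms (Linked.tail lk) (Linked.tail lk′))) (zeroʳ _) ⟩
    1# * ind (ls ≡ᴸ ms) + 0#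
      ≈⟨ trans (+-identityʳ _) (*-identityˡ _) ⟩
    ind (ls ≡ᴸ ms)
      ≈⟨ reflexive (≡.cong (λ z → ind (z ∧ (ls ≡ᴸ ms))) (≡.sym (≡ᵇ-refl l))) ⟩
    ind ((l ∷ ls) ≡ᴸ (l ∷ ms)) ∎
  ... | tri> _ _ m<l = trans (trans (J-at l ls (m ∷ ms) [])
      (alt-all {P = ℕ._< l} _ (m<l ∷ All.map (λ y<m → ℕₚ.<-trans y<m m<l) (head> lk′)) (λ y ys y<l →
        trans (⊛-[] (hh l y) (J ls ys)) (trans (*-congʳ (hh-[]-zero (ℕₚ.<⇒≢ y<l))) (zeroˡ _)))))
    (reflexive (≡.cong (λ z → ind (z ∧ (ls ≡ᴸ ms))) (≡.sym (≢⇒≡ᵇ-false l m (ℕₚ.>⇒≢ m<l)))))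

  -- The bound `p` on the first column, absent from `Free-strips`, costs nothing: once m + j reaches
  -- `p` it exceeds every row index and that column is zero.
  J-strips : ∀ p ls ms k α → All (ℕ._< p) ls → Linked ℕ._>_ ms →
    J ls ms (k ∷ α) ≈ <.strips p ms k (λ ns → J ls ns α)
  J-strips p ls []       k α ls<p lk = J-∷ ls [] k α
  J-strips p ls (m ∷ ms) k α ls<p lk = begin
    J ls (m ∷ ms) (k ∷ α)
      ≈⟨ J-∷ ls (m ∷ ms) k α ⟩
    Free (m ∷ ms) k (λ ns → J ls ns α)
      ≈⟨ Free-strips m ms k lk (J-alternating ls α) ⟩
    conv k (λ j r → <.strips m ms r (λ ns → J ls (m ℕ.+ j ∷ ns) α))
      ≈⟨ conv-cong k step ⟩
    <.strips p (m ∷ ms) k (λ ns → J ls ns α) ∎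
    where
    step : ∀ j r → <.strips m ms r (λ ns → J ls (m ℕ.+ j ∷ ns) α) ≈
                   ind (m ℕ.+ j <ᵇ p) * <.strips m ms r (λ ns → J ls (m ℕ.+ j ∷ ns) α)
    step j r with m ℕ.+ j <ᵇ p in eq
    ... | true  = sym (*-identityˡ _)
    ... | false = trans (lin-zero (<.lin-strips m ms r) (λ ns →
        J-zero-column ls (m ℕ.+ j ∷ ns) (here (All.map (λ x<p → ℕₚ.<-≤-trans x<p p≤) ls<p)) α)) (sym (zeroˡ _))
      where
      p≤ : p ℕ.≤ m ℕ.+ j
      p≤ = ℕₚ.≮⇒≥ (λ lt → contradiction (≡.trans (≡.sym eq) (<⇒<ᵇ≡true lt)) λ ())

  all<suc-sum : ∀ xs → All (ℕ._< suc (sum xs)) xs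
  all<suc-sum []       = []
  all<suc-sum (x ∷ xs) = s≤s (ℕₚ.m≤m+n x _) ∷
    All.map (λ p → ℕₚ.<-≤-trans p (s≤s (ℕₚ.m≤n+m (sum xs) x))) (all<suc-sum xs)

  -- A substitute for alternation in the rows. Strips keep the columns strictly decreasing and
  -- positive, so by induction everything reduces to the constant term, where `ls` would have to
  -- equal such a list.
  J-vanish : ∀ ls ms α → Linked ℕ._≥_ ls → ¬ (Linked ℕ._>_ ls × All (0 ℕ.<_) ls) →
    Linked ℕ._>_ ms → All (0 ℕ.<_) ms → J ls ms α ≈ 0#
  J-vanish ls ms []      lk bad lk′ pos with ls ≡ᴸ ms in eq | J-[] ls ms lk lk′
  ... | false | e = e
  ... | true  | e with ≡ᴸ⇒≡ ls ms eq
  ...   | ≡.refl = contradiction (lk′ , pos) bad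
  J-vanish ls ms (k ∷ α) lk bad lk′ pos = begin
    J ls ms (k ∷ α)
      ≈⟨ J-strips p ls ms k α (all<suc-sum ls) lk′ ⟩
    <.strips p ms k (λ ns → J ls ns α)
      ≈⟨ strips<-cong p ms k (λ ns lkn _ posn → J-vanish ls ns α lk bad (Linked.tail lkn) (posn pos)) ⟩
    <.strips p ms k (λ _ → 0#)
      ≈⟨ lin-zero (<.lin-strips p ms k) (λ _ → refl) ⟩
    0# ∎
    where p = suc (sum ls)

  -- Tableaux by rows

  rows : ℕ → ℕ → (List ℕ → Carrier) → Carrier
  rows N zero    f = f []
  rows N (suc r) f = ΣL (upTo N) (λ x → rows N r (λ row → f (x ∷ row)))

  lin-rows : ∀ N r → Lin (rows N r)
  lin-rows N zero    = lin-eval []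
  lin-rows N (suc r) = lin-ΣL (upTo N) (λ x → lin-∘ (lin-rows N r) (x ∷_))

  rows-cong : ∀ N r {f g : List ℕ → Carrier} → (∀ row → length row ≡ r → f row ≈ g row) → rows N r f ≈ rows N r g
  rows-cong N zero    e = e [] ≡.refl
  rows-cong N (suc r) e = ΣL-cong (upTo N) (λ x → rows-cong N r (λ row p → e (x ∷ row) (≡.cong suc p)))

  weakRows : ℕ → ℕ → (List ℕ → Carrier) → Carrier
  weakRows N r f = rows N r (λ row → ind (rowWeak row) * f row)

  weakRows-cong : ∀ N r {f g : List ℕ → Carrier} → (∀ row → length row ≡ r → f row ≈ g row) →
    weakRows N r f ≈ weakRows N r g
  weakRows-cong N r e = rows-cong N r (λ row p → *-congˡ (e row p))

  weakRows-zero : ∀ N r {f : List ℕ → Carrier} → (∀ row → length row ≡ r → f row ≈ 0#) → weakRows N r f ≈ 0#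
  weakRows-zero N r e = trans (weakRows-cong N r e) (lin-zero (lin-rows N r) (λ _ → zeroʳ _))

  <ᵇ-suc : ∀ x y → (x <ᵇ suc y) ≡ (x ≤ᵇ y)
  <ᵇ-suc zero    y = ≡.refl
  <ᵇ-suc (suc x) y = ≡.refl

  rowWeak-0∷ : ∀ row → rowWeak (0 ∷ row) ≡ rowWeak row
  rowWeak-0∷ []        = ≡.refl
  rowWeak-0∷ (x ∷ row) = ≡.refl

  -- After a positive letter a weakly increasing row contains no 0, so it is a row over one letter
  -- less with all entries raised.
  rows-above : ∀ N r x (f : List ℕ → Carrier) →
    rows (suc N) r (λ row → ind (rowWeak (suc x ∷ row)) * f row) ≈
    rows N r (λ row → ind (rowWeak (x ∷ row)) * f (map suc row))
  rows-above N zero    x f = refl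
  rows-above N (suc r) x f = begin
    ΣL (upTo (suc N)) (λ y → rows (suc N) r (λ row → ind ((x <ᵇ y) ∧ rowWeak (y ∷ row)) * f (y ∷ row)))
      ≈⟨ ΣL-upTo-suc N (λ y → rows (suc N) r (λ row → ind ((x <ᵇ y) ∧ rowWeak (y ∷ row)) * f (y ∷ row))) ⟩
    rows (suc N) r (λ row → 0# * f (0 ∷ row)) +
      ΣL (upTo N) (λ y → rows (suc N) r (λ row → ind ((x <ᵇ suc y) ∧ rowWeak (suc y ∷ row)) * f (suc y ∷ row)))
      ≈⟨ trans (+-congʳ (lin-zero (lin-rows (suc N) r) (λ _ → zeroˡ _))) (+-identityˡ _) ⟩
    ΣL (upTo N) (λ y → rows (suc N) r (λ row → ind ((x <ᵇ suc y) ∧ rowWeak (suc y ∷ row)) * f (suc y ∷ row)))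
      ≈⟨ ΣL-cong (upTo N) (λ y → trans (lin-cong (lin-rows (suc N) r)
             (λ row → pull (x <ᵇ suc y) (rowWeak (suc y ∷ row)) _))
           (trans (rows-above N r y (λ row → ind (x <ᵇ suc y) * f (suc y ∷ row)))
             (lin-cong (lin-rows N r) (λ row → trans (sym (pull (x <ᵇ suc y) (rowWeak (y ∷ row)) _))
               (reflexive (≡.cong (λ z → ind (z ∧ rowWeak (y ∷ row)) * f (suc y ∷ map suc row)) (<ᵇ-suc x y))))))) ⟩
    ΣL (upTo N) (λ y → rows N r (λ row → ind ((x ≤ᵇ y) ∧ rowWeak (y ∷ row)) * f (suc y ∷ map suc row))) ∎
    where
    pull : ∀ b b′ z → ind (b ∧ b′) * z ≈ ind b′ * (ind b * z)
    pull b b′ z = trans (*-congʳ (ind-∧ b b′))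
      (solve 3 (λ u v w → u :* v :* w := v :* (u :* w)) refl (ind b) (ind b′) z)

  raise : ℕ → List ℕ → List ℕ
  raise κ row = replicate κ 0 ++ map suc row

  -- The zeros of a weakly increasing row come first, so it is `raise κ row` in exactly one way.
  weakRows-suc : ∀ N r (f : List ℕ → Carrier) →
    weakRows (suc N) r f ≈ conv r (λ κ r′ → weakRows N r′ (λ row → f (raise κ row)))
  weakRows-suc N zero    f = refl
  weakRows-suc N (suc r) f = begin
    ΣL (upTo (suc N)) (λ x → rows (suc N) r (λ row → ind (rowWeak (x ∷ row)) * f (x ∷ row)))
      ≈⟨ ΣL-upTo-suc N (λ x → rows (suc N) r (λ row → ind (rowWeak (x ∷ row)) * f (x ∷ row))) ⟩
    rows (suc N) r (λ row → ind (rowWeak (0 ∷ row)) * f (0 ∷ row)) +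
      ΣL (upTo N) (λ x → rows (suc N) r (λ row → ind (rowWeak (suc x ∷ row)) * f (suc x ∷ row)))
      ≈⟨ +-cong
           (trans (lin-cong (lin-rows (suc N) r) (λ row →
                    reflexive (≡.cong (λ z → ind z * f (0 ∷ row)) (rowWeak-0∷ row))))
             (weakRows-suc N r (λ row → f (0 ∷ row))))
           (ΣL-cong (upTo N) (λ x → rows-above N r x (λ row → f (suc x ∷ row)))) ⟩
    conv r (λ κ r′ → weakRows N r′ (λ row → f (raise (suc κ) row))) + weakRows N (suc r) (λ row → f (map suc row))
      ≈⟨ +-comm _ _ ⟩
    weakRows N (suc r) (λ row → f (map suc row)) + conv r (λ κ r′ → weakRows N r′ (λ row → f (raise (suc κ) row))) ∎

  zipLt : List ℕ → List ℕ → Bool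
  zipLt []       _        = true
  zipLt (_ ∷ _)  []       = true
  zipLt (u ∷ us) (x ∷ xs) = (u <ᵇ x) ∧ zipLt us xs

  -- Column-strictness of two consecutive rows, the lower one starting a columns to the left of the upper one.
  colOK : ℕ → List ℕ → List ℕ → Bool
  colOK zero    up lo       = zipLt up lo
  colOK (suc a) up []       = true
  colOK (suc a) up (x ∷ lo) = colOK a up lo

  colOK-[] : ∀ a up → colOK a up [] ≡ true
  colOK-[] zero    []       = ≡.refl
  colOK-[] zero    (_ ∷ _)  = ≡.refl
  colOK-[] (suc a) up       = ≡.refl

  -- With κ ≤ a the zeros of the lower row lie to the left of the upper row, and those of the upper
  -- row lie above positive letters only; neither gives a condition. Deleting them moves the left
  -- ends by κ and κ₀.
  colOK-raise : ∀ a κ₀ κ up lo → κ ℕ.≤ a → colOK a (raise κ₀ up) (raise κ lo) ≡ colOK ((a ∸ κ) ℕ.+ κ₀) up lo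
  colOK-raise (suc a) κ₀ (suc κ) up lo (s≤s p) = colOK-raise a κ₀ κ up lo p
  colOK-raise (suc a) κ₀ zero up []       _ = ≡.refl
  colOK-raise (suc a) κ₀ zero up (x ∷ lo) _ = colOK-raise a κ₀ zero up lo z≤n
  colOK-raise zero κ₀ zero up lo _ = zip κ₀ up lo
    where
    zip : ∀ κ₀ up lo → zipLt (raise κ₀ up) (map suc lo) ≡ colOK κ₀ up lo
    zip zero     []       lo       = ≡.refl
    zip zero     (u ∷ up) []       = ≡.refl
    zip zero     (u ∷ up) (x ∷ lo) = ≡.cong ((u <ᵇ x) ∧_) (zip zero up lo)
    zip (suc κ₀) up       []       = ≡.refl
    zip (suc κ₀) up       (x ∷ lo) = zip κ₀ up lo

  colOK-false : ∀ a κ up lo → a ℕ.< κ → 0 ℕ.< length up → colOK a up (raise κ lo) ≡ false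
  colOK-false zero    (suc κ) (u ∷ up) lo _       _ = ≡.refl
  colOK-false (suc a) (suc κ) up       lo (s≤s p) q = colOK-false a κ up lo p q

  -- Sum of φ (reading word) over the semistandard fillings of λ/μ with letters 0 , … , N - 1, the row above the
  -- first one being up, in columns m₀ , … , l₀ - 1.
  tableaux : ℕ → ℕ → ℕ → List ℕ → List ℕ → List ℕ → (List ℕ → Carrier) → Carrier
  tableaux N l₀ m₀ up []       []       φ = φ []
  tableaux N l₀ m₀ up (l ∷ ls) (m ∷ ms) φ = ind (m ≤ᵇ l) * weakRows N (l ∸ m) (λ row →
    ind (colOK (m₀ ∸ m) up row) * tableaux N l m row ls ms (λ w → φ (row ++ w)))
  tableaux N l₀ m₀ up _        _        φ = 0#

  lin-tableaux : ∀ N l₀ m₀ up ls ms → Lin (tableaux N l₀ m₀ up ls ms)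
  lin-tableaux N l₀ m₀ up []       []       = lin-eval []
  lin-tableaux N l₀ m₀ up []       (m ∷ ms) = lin-0
  lin-tableaux N l₀ m₀ up (l ∷ ls) []       = lin-0
  lin-tableaux N l₀ m₀ up (l ∷ ls) (m ∷ ms) = lin-* _ (linRows (l ∸ m) (λ row →
      lin-* _ (lin-* _ (lin-∘ (lin-tableaux N l m row ls ms) (row ++_)))))
    where
    linRows : ∀ r {T : List ℕ → (List ℕ → Carrier) → Carrier} → (∀ row → Lin (T row)) →
              Lin (λ Φ → rows N r (λ row → T row Φ))
    linRows zero    t = t []
    linRows (suc r) t = lin-ΣL (upTo N) (λ x → linRows r (λ row → t (x ∷ row)))

  zeros : List ℕ → ℕ
  zeros []          = 0
  zeros (zero ∷ w)  = suc (zeros w)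
  zeros (suc x ∷ w) = zeros w

  lower : List ℕ → List ℕ
  lower []          = []
  lower (zero ∷ w)  = lower w
  lower (suc x ∷ w) = x ∷ lower w

  zeros-raise : ∀ κ row w → zeros (raise κ row ++ w) ≡ κ ℕ.+ zeros w
  zeros-raise zero    []        w = ≡.refl
  zeros-raise zero    (x ∷ row) w = zeros-raise zero row w
  zeros-raise (suc κ) row       w = ≡.cong suc (zeros-raise κ row w)

  lower-raise : ∀ κ row w → lower (raise κ row ++ w) ≡ row ++ lower w
  lower-raise zero    []        w = ≡.refl
  lower-raise zero    (x ∷ row) w = ≡.cong (x ∷_) (lower-raise zero row w)
  lower-raise (suc κ) row       w = lower-raise κ row w

  -- Two sums of different totals are matched by their first index; terms whose index exceeds the
  -- other total must vanish by themselves.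
  conv-match : ∀ K k {F G : ℕ → ℕ → Carrier} →
    (∀ i r s → i ℕ.+ r ≡ K → i ℕ.+ s ≡ k → F i r ≈ G i s) →
    (∀ i r → i ℕ.+ r ≡ K → k ℕ.< i → F i r ≈ 0#) →
    (∀ i s → i ℕ.+ s ≡ k → K ℕ.< i → G i s ≈ 0#) → conv K F ≈ conv k G
  conv-match zero    zero    e eF eG = e 0 0 0 ≡.refl ≡.refl
  conv-match zero    (suc k) e eF eG = sym (trans (+-cong (sym (e 0 0 (suc k) ≡.refl ≡.refl))
    (trans (conv-cong≡ k (λ i s p → eG (suc i) s (≡.cong suc p) (s≤s z≤n))) (conv-0 k (λ _ _ → refl)))) (+-identityʳ _))
  conv-match (suc K) zero    e eF eG = trans (+-cong (e 0 (suc K) 0 ≡.refl ≡.refl)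
    (trans (conv-cong≡ K (λ i r p → eF (suc i) r (≡.cong suc p) (s≤s z≤n))) (conv-0 K (λ _ _ → refl)))) (+-identityʳ _)
  conv-match (suc K) (suc k) e eF eG = +-cong (e 0 (suc K) (suc k) ≡.refl ≡.refl)
    (conv-match K k (λ i r s p q → e (suc i) r s (≡.cong suc p) (≡.cong suc q))
      (λ i r p lt → eF (suc i) r (≡.cong suc p) (s≤s lt)) (λ i s p lt → eG (suc i) s (≡.cong suc p) (s≤s lt)))

  ≤⇒≤ᵇ≡true : ∀ {m n} → m ℕ.≤ n → (m ≤ᵇ n) ≡ true
  ≤⇒≤ᵇ≡true {m} {n} p with m ≤ᵇ n | ℕₚ.≤⇒≤ᵇ p
  ... | true | _ = ≡.refl

  ≤ᵇ≡true⇒≤ : ∀ m n → (m ≤ᵇ n) ≡ true → m ℕ.≤ n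
  ≤ᵇ≡true⇒≤ m n e = ℕₚ.≤ᵇ⇒≤ m n (≡.subst T (≡.sym e) _)

  >⇒≤ᵇ≡false : ∀ {m n} → n ℕ.< m → (m ≤ᵇ n) ≡ false
  >⇒≤ᵇ≡false {m} {n} p with m ≤ᵇ n in eq
  ... | false = ≡.refl
  ... | true  = contradiction (≤ᵇ≡true⇒≤ m n eq) (ℕₚ.<⇒≱ p)

  ≡ᵇ-sym : ∀ m n → (m ≡ᵇ n) ≡ (n ≡ᵇ m)
  ≡ᵇ-sym zero    zero    = ≡.refl
  ≡ᵇ-sym zero    (suc n) = ≡.refl
  ≡ᵇ-sym (suc m) zero    = ≡.refl
  ≡ᵇ-sym (suc m) (suc n) = ≡ᵇ-sym m n

  module ≤ = Strip _≤ᵇ_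

  strips≤-cong : ∀ p ms k {Φ Ψ : List ℕ → Carrier} →
    (∀ ns → Linked ℕ._≥_ (p ∷ ns) → length ns ≡ length ms → Φ ns ≈ Ψ ns) →
    ≤.strips p ms k Φ ≈ ≤.strips p ms k Ψ
  strips≤-cong p ms k e = ≤.strips-cong ≤ᵇ≡true⇒≤ (λ n≤p x≤n → ℕₚ.≤-trans x≤n n≤p) p ms k (λ ns lk len _ → e ns lk len)

  -- Removing the smallest letter from a tableau of shape λ/μ leaves a tableau of shape λ/ν,
  -- where ν/μ is the horizontal strip occupied by that letter.
  tableaux-strips : ∀ N l₀ m₀ κ₀ up ls ms k {φ ψ : List ℕ → Carrier} →
    Linked ℕ._≥_ (l₀ ∷ ls) → Linked ℕ._≥_ (m₀ ∷ ms) → length (raise κ₀ up) ≡ l₀ ∸ m₀ →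
    (∀ w → φ w ≈ ind (zeros w ≡ᵇ k) * ψ (lower w)) →
    tableaux (suc N) l₀ m₀ (raise κ₀ up) ls ms φ ≈
    ≤.strips m₀ ms k (λ ns → tableaux N l₀ (m₀ ℕ.+ κ₀) up ls ns ψ)
  tableaux-strips N l₀ m₀ κ₀ up [] [] k lkl lkm len e =
    trans (e []) (*-congʳ (reflexive (≡.cong ind (≡ᵇ-sym 0 k))))
  tableaux-strips N l₀ m₀ κ₀ up [] (m ∷ ms) k lkl lkm len e =
    sym (conv-0 k (λ j r → trans (*-congˡ (lin-zero (≤.lin-strips m ms r) (λ _ → refl))) (zeroʳ _)))
  tableaux-strips N l₀ m₀ κ₀ up (l ∷ ls) [] k lkl lkm len e = sym (zeroʳ _)
  tableaux-strips N l₀ m₀ κ₀ up (l ∷ ls) (m ∷ ms) k {φ} {ψ} (l≤l₀ ∷ lkl) (m≤m₀ ∷ lkm) len e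
    with m ≤ᵇ l in eq
  -- When m > l already, a strip only moves the left end m + j further past l, so the right side
  -- vanishes too.
  ... | false = trans (zeroˡ _) (sym (conv-0 k (λ j r → trans (*-congˡ (lin-zero (≤.lin-strips m ms r)
          (λ ns → trans (*-congʳ (reflexive (≡.cong ind (>⇒≤ᵇ≡false {m ℕ.+ j} {l}
            (ℕₚ.<-≤-trans l<m (ℕₚ.m≤m+n m j)))))) (zeroˡ _))))
          (zeroʳ _))))
    where
    l<m : l ℕ.< m
    l<m = ℕₚ.≰⇒> (λ p → contradiction (≡.trans (≡.sym eq) (≤⇒≤ᵇ≡true p)) λ ())
  ... | true = begin
    1# * weakRows (suc N) (l ∸ m) G
      ≈⟨ *-identityˡ _ ⟩
    weakRows (suc N) (l ∸ m) G
      ≈⟨ weakRows-suc N (l ∸ m) G ⟩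
    conv (l ∸ m) (λ κ r → weakRows N r (λ row → G (raise κ row)))
      -- κ, the number of smallest letters in this row, indexes both sums: on the left it is limited
      -- by the row length, on the right by the total number `k` of such letters.
      ≈⟨ conv-match (l ∸ m) k same tooMany tooLong ⟩
    conv k (λ κ s → ind (m ℕ.+ κ ≤ᵇ m₀) * ≤.strips m ms s (λ ns →
      tableaux N l₀ (m₀ ℕ.+ κ₀) up (l ∷ ls) (m ℕ.+ κ ∷ ns) ψ)) ∎
    where
    m≤l : m ℕ.≤ l
    m≤l = ≤ᵇ≡true⇒≤ m l eq
    up⁺ = raise κ₀ up
    G : List ℕ → Carrier
    G row = ind (colOK (m₀ ∸ m) up⁺ row) * tableaux (suc N) l m row ls ms (λ w → φ (row ++ w))
    G′ : ℕ → List ℕ → List ℕ → Carrier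
    G′ κ row ns = ind (colOK (m₀ ℕ.+ κ₀ ∸ (m ℕ.+ κ)) up row) * tableaux N l (m ℕ.+ κ) row ls ns (λ w → ψ (row ++ w))

    length-raise : ∀ κ row → length (raise κ row) ≡ κ ℕ.+ length row
    length-raise κ row = ≡.trans (length-++ (replicate κ 0)) (≡.cong₂ ℕ._+_ (length-replicate κ) (length-map suc row))

    split : ∀ κ row w → φ (raise κ row ++ w) ≈ ind (κ ℕ.+ zeros w ≡ᵇ k) * ψ (row ++ lower w)
    split κ row w = trans (e _) (reflexive
      (≡.cong₂ (λ z z′ → ind (z ≡ᵇ k) * ψ z′) (zeros-raise κ row w) (lower-raise κ row w)))

    tooMany : ∀ κ r → κ ℕ.+ r ≡ l ∸ m → k ℕ.< κ → weakRows N r (λ row → G (raise κ row)) ≈ 0#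
    tooMany κ r _ k<κ = weakRows-zero N r (λ row _ → trans (*-congˡ
      (lin-zero (lin-tableaux (suc N) l m (raise κ row) ls ms) (λ w →
      trans (split κ row w) (trans (*-congʳ (reflexive (≡.cong ind (≢⇒≡ᵇ-false _ _
        (λ p → ℕₚ.<⇒≱ k<κ (≡.subst (κ ℕ.≤_) p (ℕₚ.m≤m+n κ _))))))) (zeroˡ _))))) (zeroʳ _))

    tooLong : ∀ κ s → κ ℕ.+ s ≡ k → l ∸ m ℕ.< κ → ind (m ℕ.+ κ ≤ᵇ m₀) * ≤.strips m ms s (λ ns →
      tableaux N l₀ (m₀ ℕ.+ κ₀) up (l ∷ ls) (m ℕ.+ κ ∷ ns) ψ) ≈ 0#
    tooLong κ s _ lt = trans (*-congˡ (lin-zero (≤.lin-strips m ms s) (λ ns →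
      trans (*-congʳ (reflexive (≡.cong ind (>⇒≤ᵇ≡false {m ℕ.+ κ} {l} l<)))) (zeroˡ _)))) (zeroʳ _)
      where
      l< : l ℕ.< m ℕ.+ κ
      l< = ≡.subst (ℕ._< m ℕ.+ κ) (ℕₚ.m+[n∸m]≡n m≤l) (ℕₚ.+-monoʳ-< m lt)

    same : ∀ κ r s → κ ℕ.+ r ≡ l ∸ m → κ ℕ.+ s ≡ k → weakRows N r (λ row → G (raise κ row)) ≈
      ind (m ℕ.+ κ ≤ᵇ m₀) * ≤.strips m ms s (λ ns → tableaux N l₀ (m₀ ℕ.+ κ₀) up (l ∷ ls) (m ℕ.+ κ ∷ ns) ψ)
    same κ r s p q with m ℕ.+ κ ≤ᵇ m₀ in eq₀
    ... | false = trans (weakRows-zero N r (λ row _ → trans (*-congʳ (reflexive (≡.cong ind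
            (colOK-false (m₀ ∸ m) κ up⁺ row a<κ up⁺≢[])))) (zeroˡ _))) (sym (zeroˡ _))
      where
      m₀<m+κ : m₀ ℕ.< m ℕ.+ κ
      m₀<m+κ = ℕₚ.≰⇒> (λ t → contradiction (≡.trans (≡.sym eq₀) (≤⇒≤ᵇ≡true t)) λ ())
      a<κ : m₀ ∸ m ℕ.< κ
      a<κ = ℕₚ.+-cancelˡ-< m _ _ (≡.subst (ℕ._< m ℕ.+ κ) (≡.sym (ℕₚ.m+[n∸m]≡n m≤m₀)) m₀<m+κ)
      m+κ≤l : m ℕ.+ κ ℕ.≤ l
      m+κ≤l = ≡.subst (m ℕ.+ κ ℕ.≤_) (ℕₚ.m+[n∸m]≡n m≤l) (ℕₚ.+-monoʳ-≤ m (≡.subst (κ ℕ.≤_) p (ℕₚ.m≤m+n κ r)))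
      -- The offending 0 lies in column m₀, and m₀ < m + κ ≤ l ≤ l₀ shows that the upper row has a
      -- cell there.
      up⁺≢[] : 0 ℕ.< length up⁺
      up⁺≢[] = ≡.subst (0 ℕ.<_) (≡.sym len) (ℕₚ.m<n⇒0<n∸m (ℕₚ.<-≤-trans m₀<m+κ (ℕₚ.≤-trans m+κ≤l l≤l₀)))
    ... | true = begin
      weakRows N r (λ row → G (raise κ row))
        ≈⟨ weakRows-cong N r (λ row lr → *-cong
             (reflexive (≡.cong ind (≡.trans (colOK-raise (m₀ ∸ m) κ₀ κ up row κ≤a)
                                    (≡.cong (λ z → colOK z up row) shift))))
             (tableaux-strips N l m κ row ls ms s lkl lkm
               (≡.trans (length-raise κ row) (≡.trans (≡.cong (κ ℕ.+_) lr) p))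
               (λ w → trans (split κ row w) (*-congʳ (reflexive (≡.cong ind (cancel (zeros w)))))))) ⟩
      weakRows N r (λ row → ind (colOK (m₀ ℕ.+ κ₀ ∸ (m ℕ.+ κ)) up row) *
        ≤.strips m ms s (λ ns → tableaux N l (m ℕ.+ κ) row ls ns (λ w → ψ (row ++ w))))
        ≈⟨ weakRows-cong N r (λ row _ → sym (lin-scale (≤.lin-strips m ms s) _
             (λ ns → tableaux N l (m ℕ.+ κ) row ls ns (λ w → ψ (row ++ w))))) ⟩
      rows N r (λ row → ind (rowWeak row) * ≤.strips m ms s (G′ κ row))
        ≈⟨ rows-cong N r (λ row _ → sym (lin-scale (≤.lin-strips m ms s) (ind (rowWeak row)) (G′ κ row))) ⟩
      rows N r (λ row → ≤.strips m ms s (λ ns → ind (rowWeak row) * G′ κ row ns))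
        ≈⟨ lin-swap (lin-rows N r) (≤.lin-strips m ms s) (λ row ns → ind (rowWeak row) * G′ κ row ns) ⟩
      ≤.strips m ms s (λ ns → weakRows N r (λ row → G′ κ row ns))
        ≈⟨ lin-cong (≤.lin-strips m ms s) (λ ns → sym (trans
             (*-cong (reflexive (≡.cong ind (≤⇒≤ᵇ≡true m+κ≤l)))
               (reflexive (≡.cong (λ z → weakRows N z (λ row → G′ κ row ns)) l∸)))
             (*-identityˡ _))) ⟩
      ≤.strips m ms s (λ ns → tableaux N l₀ (m₀ ℕ.+ κ₀) up (l ∷ ls) (m ℕ.+ κ ∷ ns) ψ)
        ≈⟨ *-identityˡ _ ⟨
      1# * ≤.strips m ms s (λ ns → tableaux N l₀ (m₀ ℕ.+ κ₀) up (l ∷ ls) (m ℕ.+ κ ∷ ns) ψ) ∎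
      where
      m+κ≤m₀ : m ℕ.+ κ ℕ.≤ m₀
      m+κ≤m₀ = ≤ᵇ≡true⇒≤ (m ℕ.+ κ) m₀ eq₀
      κ≤a : κ ℕ.≤ m₀ ∸ m
      κ≤a = ℕₚ.+-cancelˡ-≤ m _ _ (≡.subst (m ℕ.+ κ ℕ.≤_) (≡.sym (ℕₚ.m+[n∸m]≡n m≤m₀)) m+κ≤m₀)
      m+κ+r≡l : m ℕ.+ κ ℕ.+ r ≡ l
      m+κ+r≡l = ≡.trans (ℕₚ.+-assoc m κ r) (≡.trans (≡.cong (m ℕ.+_) p) (ℕₚ.m+[n∸m]≡n m≤l))
      m+κ≤l : m ℕ.+ κ ℕ.≤ l
      m+κ≤l = ≡.subst (m ℕ.+ κ ℕ.≤_) m+κ+r≡l (ℕₚ.m≤m+n _ r)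
      l∸ : l ∸ (m ℕ.+ κ) ≡ r
      l∸ = ≡.trans (≡.cong (_∸ (m ℕ.+ κ)) (≡.sym m+κ+r≡l)) (ℕₚ.m+n∸m≡n (m ℕ.+ κ) r)
      shift : (m₀ ∸ m ∸ κ) ℕ.+ κ₀ ≡ m₀ ℕ.+ κ₀ ∸ (m ℕ.+ κ)
      shift = ≡.trans (≡.cong (ℕ._+ κ₀) (ℕₚ.∸-+-assoc m₀ m κ)) (≡.sym (ℕₚ.+-∸-comm κ₀ m+κ≤m₀))
      cancel : ∀ z → (κ ℕ.+ z ≡ᵇ k) ≡ (z ≡ᵇ s)
      cancel z = ≡.trans (≡.cong (κ ℕ.+ z ≡ᵇ_) (≡.sym q)) (+-≡ᵇ κ z s)

  -- Skew Schur functions as determinants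

  -- Recursive form of `hasContent`, made so that the hypothesis of `tableaux-strips` holds by
  -- `refl`. It is applied with `length α` letters, so at `[]` no letters remain to be counted.
  content : List ℕ → List ℕ → Carrier
  content []      w = 1#
  content (k ∷ α) w = ind (zeros w ≡ᵇ k) * content α (lower w)

  tableaux-[] : ∀ l₀ m₀ up ls ms {φ : List ℕ → Carrier} → (∀ w → φ w ≈ 1#) →
    tableaux 0 l₀ m₀ up ls ms φ ≈ ind (ls ≡ᴸ ms)
  tableaux-[] l₀ m₀ up []       []       e = e []
  tableaux-[] l₀ m₀ up []       (m ∷ ms) e = refl
  tableaux-[] l₀ m₀ up (l ∷ ls) []       e = refl
  tableaux-[] l₀ m₀ up (l ∷ ls) (m ∷ ms) {φ} e with ℕₚ.<-cmp l m
  ... | tri< l<m _ _ = trans (trans (*-congʳ (reflexive (≡.cong ind (>⇒≤ᵇ≡false l<m)))) (zeroˡ _))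
    (reflexive (≡.cong (λ z → ind (z ∧ (ls ≡ᴸ ms))) (≡.sym (≢⇒≡ᵇ-false l m (ℕₚ.<⇒≢ l<m)))))
  ... | tri> _ _ m<l with l ∸ m in eq
  ...   | zero  = contradiction (ℕₚ.m∸n≡0⇒m≤n eq) (ℕₚ.<⇒≱ m<l)
  ...   | suc _ = trans (zeroʳ _)
    (reflexive (≡.cong (λ z → ind (z ∧ (ls ≡ᴸ ms))) (≡.sym (≢⇒≡ᵇ-false l m (ℕₚ.>⇒≢ m<l)))))
  tableaux-[] l₀ m₀ up (l ∷ ls) (m ∷ ms) {φ} e | tri≈ _ ≡.refl _ = begin
    ind (l ≤ᵇ l) * weakRows 0 (l ∸ l) F
      ≈⟨ *-cong (reflexive (≡.cong ind (≤⇒≤ᵇ≡true (ℕₚ.≤-refl {l}))))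
                (reflexive (≡.cong (λ z → weakRows 0 z F) (ℕₚ.n∸n≡0 l))) ⟩
    1# * (1# * F [])
      ≈⟨ trans (*-identityˡ _) (*-identityˡ _) ⟩
    ind (colOK (m₀ ∸ l) up []) * tableaux 0 l l [] ls ms φ
      ≈⟨ *-cong (reflexive (≡.cong ind (colOK-[] (m₀ ∸ l) up))) (tableaux-[] l l [] ls ms e) ⟩
    1# * ind (ls ≡ᴸ ms)
      ≈⟨ *-identityˡ _ ⟩
    ind (ls ≡ᴸ ms)
      ≈⟨ reflexive (≡.cong (λ z → ind (z ∧ (ls ≡ᴸ ms))) (≡.sym (≡ᵇ-refl l))) ⟩
    ind ((l ∷ ls) ≡ᴸ (l ∷ ms)) ∎
    where
    F : List ℕ → Carrier
    F row = ind (colOK (m₀ ∸ l) up row) * tableaux 0 l l row ls ms (λ w → φ (row ++ w))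

  -- λᵢ ↦ λᵢ - i + (length λ + 1): the offset keeps the entries positive, so that pred below is never 0 ↦ 0.
  shift : List ℕ → List ℕ
  shift []       = []
  shift (x ∷ xs) = x ℕ.+ suc (length xs) ∷ shift xs

  length-shift : ∀ xs → length (shift xs) ≡ length xs
  length-shift []       = ≡.refl
  length-shift (x ∷ xs) = ≡.cong suc (length-shift xs)

  shift-> : ∀ {xs} → Linked ℕ._≥_ xs → Linked ℕ._>_ (shift xs)
  shift-> []       = []
  shift-> [-]      = [-]
  shift-> {x ∷ y ∷ xs} (p ∷ lk) = ℕₚ.+-mono-≤-< p (ℕₚ.n<1+n (suc (length xs))) ∷ shift-> lk

  shift-pos : ∀ xs → All (0 ℕ.<_) (shift xs)
  shift-pos []       = []
  shift-pos (x ∷ xs) = ℕₚ.<-≤-trans (s≤s z≤n) (ℕₚ.m≤n+m (suc (length xs)) x) ∷ shift-pos xs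

  shift-≡ᴸ : ∀ xs ys → length xs ≡ length ys → (shift xs ≡ᴸ shift ys) ≡ (xs ≡ᴸ ys)
  shift-≡ᴸ []       []       e = ≡.refl
  shift-≡ᴸ (x ∷ xs) (y ∷ ys) e = ≡.cong₂ _∧_
    (≡.trans (≡.cong₂ _≡ᵇ_ (ℕₚ.+-comm x _) (≡.trans (≡.cong (λ z → y ℕ.+ z) (≡.sym e)) (ℕₚ.+-comm y _)))
             (+-≡ᵇ (suc (length xs)) x y))
    (shift-≡ᴸ xs ys (ℕₚ.suc-injective e))

  >⇒≥ : ∀ {xs} → Linked ℕ._>_ xs → Linked ℕ._≥_ xs
  >⇒≥ = Linked.map ℕₚ.<⇒≤

  +-<ᵇ : ∀ n x y → (n ℕ.+ x <ᵇ n ℕ.+ y) ≡ (x <ᵇ y)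
  +-<ᵇ zero    x y = ≡.refl
  +-<ᵇ (suc n) x y = +-<ᵇ n x y

  -- Neighbouring entries are shifted by amounts differing by one, which turns the weak interlacing
  -- of partitions into the strict one of their shifted parts.
  strips-shift : ∀ p xs k (Φ : List ℕ → Carrier) →
    ≤.strips p xs k (λ ns → Φ (shift ns)) ≈ <.strips (p ℕ.+ suc (length xs)) (shift xs) k Φ
  strips-shift p []       k Φ = refl
  strips-shift p (x ∷ xs) k Φ = conv-cong k λ j r → *-cong (reflexive (≡.cong ind (bound j)))
    (begin
      ≤.strips x xs r (λ ns → Φ (x ℕ.+ j ℕ.+ suc (length ns) ∷ shift ns))
        ≈⟨ strips≤-cong x xs r (λ ns _ len → reflexive (≡.cong (λ z → Φ (z ∷ shift ns))
             (≡.trans (≡.cong (λ z → x ℕ.+ j ℕ.+ suc z) len) (comm j)))) ⟩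
      ≤.strips x xs r (λ ns → Φ (x ℕ.+ suc n ℕ.+ j ∷ shift ns))
        ≈⟨ strips-shift x xs r (λ ns → Φ (x ℕ.+ suc n ℕ.+ j ∷ ns)) ⟩
      <.strips (x ℕ.+ suc n) (shift xs) r (λ ns → Φ (x ℕ.+ suc n ℕ.+ j ∷ ns)) ∎)
    where
    n = length xs
    comm : ∀ j → x ℕ.+ j ℕ.+ suc n ≡ x ℕ.+ suc n ℕ.+ j
    comm j = ≡.trans (ℕₚ.+-assoc x j _) (≡.trans (≡.cong (x ℕ.+_) (ℕₚ.+-comm j _)) (≡.sym (ℕₚ.+-assoc x _ j)))
    bound : ∀ j → (x ℕ.+ j ≤ᵇ p) ≡ (x ℕ.+ suc n ℕ.+ j <ᵇ p ℕ.+ suc (suc n))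
    bound j = ≡.sym (≡.trans (≡.cong₂ _<ᵇ_ (≡.trans (≡.sym (comm j)) (ℕₚ.+-comm _ (suc n)))
        (≡.trans (ℕₚ.+-suc p (suc n)) (≡.trans (≡.cong suc (ℕₚ.+-comm p (suc n))) (≡.sym (ℕₚ.+-suc (suc n) p)))))
      (≡.trans (+-<ᵇ (suc n) (x ℕ.+ j) (suc p)) (<ᵇ-suc (x ℕ.+ j) p)))

  -- The empty row in column B serves as an unconstraining row above the first one.
  tableaux≈J : ∀ B α ls ms → length ls ≡ length ms → Linked ℕ._≥_ (B ∷ ls) → Linked ℕ._≥_ (B ∷ ms) →
    tableaux (length α) B B [] ls ms (content α) ≈ J (shift ls) (shift ms) α
  tableaux≈J B [] ls ms len lkl lkm = begin
    tableaux 0 B B [] ls ms (content [])  ≈⟨ tableaux-[] B B [] ls ms (λ _ → refl) ⟩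
    ind (ls ≡ᴸ ms)                        ≈⟨ reflexive (≡.cong ind (shift-≡ᴸ ls ms len)) ⟨
    ind (shift ls ≡ᴸ shift ms)            ≈⟨ J-[] (shift ls) (shift ms) (>⇒≥ (shift-> (Linked.tail lkl)))
                                                (shift-> (Linked.tail lkm)) ⟨
    J (shift ls) (shift ms) [] ∎
  tableaux≈J B (k ∷ α) ls ms len lkl lkm = begin
    tableaux (suc (length α)) B B [] ls ms (content (k ∷ α))
      ≈⟨ tableaux-strips (length α) B B 0 [] ls ms k lkl lkm (≡.sym (ℕₚ.n∸n≡0 B)) (λ _ → refl) ⟩
    ≤.strips B ms k (λ ns → tableaux (length α) B (B ℕ.+ 0) [] ls ns (content α))
      ≈⟨ strips≤-cong B ms k (λ ns lkn lenn → trans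
           (reflexive (≡.cong (λ z → tableaux (length α) B z [] ls ns (content α)) (ℕₚ.+-identityʳ B)))
           (tableaux≈J B α ls ns (≡.trans len (≡.sym lenn)) lkl lkn)) ⟩
    ≤.strips B ms k (λ ns → J (shift ls) (shift ns) α)
      ≈⟨ strips-shift B ms k (λ ns → J (shift ls) ns α) ⟩
    <.strips (B ℕ.+ suc (length ms)) (shift ms) k (λ ns → J (shift ls) ns α)
      ≈⟨ J-strips (B ℕ.+ suc (length ms)) (shift ls) (shift ms) k α
           (≡.subst (λ z → All (ℕ._< B ℕ.+ suc z) (shift ls)) len (head> (shift-> lkl))) (shift-> (Linked.tail lkm)) ⟨
    J (shift ls) (shift ms) (k ∷ α) ∎

  -- From the Boolean tableau count to the row-by-row sum

  and-upTo-suc : ∀ n (f : ℕ → Bool) → and (map f (upTo (suc n))) ≡ f 0 ∧ and (map (f ∘ suc) (upTo n))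
  and-upTo-suc n f = ≡.cong (λ z → f 0 ∧ and z)
    (≡.trans (map-applyUpTo suc f n) (≡.sym (map-applyUpTo id (f ∘ suc) n)))

  and-upTo-cong : ∀ n {f g : ℕ → Bool} → (∀ j → f j ≡ g j) → and (map f (upTo n)) ≡ and (map g (upTo n))
  and-upTo-cong n e = ≡.cong and (map-cong e (upTo n))

  and-upTo-true : ∀ n {f : ℕ → Bool} → (∀ j → f j ≡ true) → and (map f (upTo n)) ≡ true
  and-upTo-true zero    e = ≡.refl
  and-upTo-true (suc n) {f} e = ≡.trans (and-upTo-suc n f) (≡.cong₂ _∧_ (e 0) (and-upTo-true n (λ j → e (suc j))))

  hd : List ℕ → ℕ
  hd xs = lookupD xs 0

  tl : List ℕ → List ℕ
  tl = drop 1

  lookupD-tl : ∀ xs r → lookupD xs (suc r) ≡ lookupD (tl xs) r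
  lookupD-tl []       r = ≡.refl
  lookupD-tl (x ∷ xs) r = ≡.refl

  containedᵇ-step : ∀ la mu → containedᵇ la mu ≡ (hd mu ≤ᵇ hd la) ∧ containedᵇ (tl la) (tl mu)
  containedᵇ-step la []       = ≡.refl
  containedᵇ-step la (y ∷ mu) = ≡.trans (and-upTo-suc (length mu) (λ r → lookupD (y ∷ mu) r ≤ᵇ lookupD la r))
    (≡.cong ((y ≤ᵇ hd la) ∧_) (and-upTo-cong (length mu) (λ r → ≡.cong (lookupD mu r ≤ᵇ_) (lookupD-tl la r))))

  rowLengths-∷ : ∀ x la mu → rowLengths (x ∷ la) mu ≡ (x ∸ hd mu) ∷ rowLengths la (tl mu)
  rowLengths-∷ x la mu = ≡.cong ((x ∸ hd mu) ∷_) (≡.trans (map-applyUpTo suc _ (length la))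
    (≡.trans (≡.sym (map-applyUpTo id _ (length la)))
      (map-cong (λ r → ≡.cong (lookupD la r ∸_) (lookupD-tl mu r)) (upTo (length la)))))

  -- `colStrict` with the row index replaced by tails and the row above passed as an argument, as in
  -- `tableaux`.
  colRows : ℕ → ℕ → List ℕ → List ℕ → List ℕ → List (List ℕ) → Bool
  colRows l₀ m₀ up la mu []          = true
  colRows l₀ m₀ up la mu (lo ∷ rows) = colPair m₀ l₀ (hd mu) up lo ∧ colRows (hd la) (hd mu) lo (tl la) (tl mu) rows

  colStrict-tl : ∀ la mu r T → colStrict la mu (suc r) T ≡ colStrict (tl la) (tl mu) r T
  colStrict-tl la mu r []              = ≡.refl
  colStrict-tl la mu r (x ∷ [])        = ≡.refl
  colStrict-tl la mu r (up ∷ lo ∷ T) = ≡.cong₂ _∧_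
    (≡.trans (≡.cong₂ (λ z z′ → colPair z z′ (lookupD mu (suc (suc r))) up lo) (lookupD-tl mu r) (lookupD-tl la r))
      (≡.cong (λ z → colPair (lookupD (tl mu) r) (lookupD (tl la) r) z up lo) (lookupD-tl mu (suc r))))
    (colStrict-tl la mu (suc r) (lo ∷ T))

  colStrict-rows : ∀ la mu lo T → colStrict la mu 0 (lo ∷ T) ≡ colRows (hd la) (hd mu) lo (tl la) (tl mu) T
  colStrict-rows la mu up []       = ≡.refl
  colStrict-rows la mu up (lo ∷ T) = ≡.cong₂ _∧_
    (≡.cong (λ z → colPair (hd mu) (hd la) z up lo) (lookupD-tl mu 0))
    (≡.trans (colStrict-tl la mu 0 (lo ∷ T)) (colStrict-rows (tl la) (tl mu) lo T))

  if-false : ∀ {b} {x y : Bool} → b ≡ false → (if b then x else y) ≡ y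
  if-false ≡.refl = ≡.refl

  ≤ᵇ∧<ᵇ-empty : ∀ m l c′ → l ℕ.≤ m → ((m ≤ᵇ c′) ∧ (c′ <ᵇ l)) ≡ false
  ≤ᵇ∧<ᵇ-empty m l c′ p with m ≤ᵇ c′ in e₁ | c′ <ᵇ l in e₂
  ... | false | _     = ≡.refl
  ... | true  | false = ≡.refl
  ... | true  | true  = contradiction (ℕₚ.<-≤-trans (<ᵇ≡true⇒< c′ l e₂) p) (ℕₚ.≤⇒≯ (≤ᵇ≡true⇒≤ m c′ e₁))

  colPair-top : ∀ B m up lo → colPair B B m up lo ≡ true
  colPair-top B m up lo = and-upTo-true (length lo) (λ j → if-false (≤ᵇ∧<ᵇ-empty B B (m ℕ.+ j) ℕₚ.≤-refl))

  colStrict≡colRows : ∀ B la mu T → colStrict la mu 0 T ≡ colRows B B [] la mu T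
  colStrict≡colRows B la mu []       = ≡.refl
  colStrict≡colRows B la mu (lo ∷ T) = ≡.trans (colStrict-rows la mu lo T)
    (≡.cong (_∧ colRows (hd la) (hd mu) lo (tl la) (tl mu) T) (≡.sym (colPair-top B (hd mu) [] lo)))

  -- Induction along the lower row: cells left of the upper row are dropped while `a` decreases,
  -- afterwards both rows lose a cell. The length hypothesis identifies the column test c < l₀ with
  -- the upper list not being exhausted.
  colPair≡colOK : ∀ a m l₀ up lo → length up ≡ l₀ ∸ (a ℕ.+ m) → colPair (a ℕ.+ m) l₀ m up lo ≡ colOK a up lo
  colPair≡colOK a       m l₀ up       []       len = ≡.sym (colOK-[] a up)
  colPair≡colOK (suc a) m l₀ up       (x ∷ lo) len = ≡.trans
    (and-upTo-suc (length lo) (entry (suc a ℕ.+ m) m (x ∷ lo)))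
    (≡.cong₂ _∧_ (if-false (≡.cong (_∧ (m ℕ.+ 0 <ᵇ l₀)) (>⇒≤ᵇ≡false {suc a ℕ.+ m} {m ℕ.+ 0}
        (s≤s (≡.subst (ℕ._≤ a ℕ.+ m) (≡.sym (ℕₚ.+-identityʳ m)) (ℕₚ.m≤n+m m a))))))
      (≡.trans (and-upTo-cong (length lo) (λ j → ≡.cong₂ (λ z c′ → if (z ≤ᵇ c′) ∧ (c′ <ᵇ l₀)
          then lookupD up (c′ ∸ z) <ᵇ lookupD lo j else true) (≡.sym (ℕₚ.+-suc a m)) (ℕₚ.+-suc m j)))
        (colPair≡colOK a (suc m) l₀ up lo (≡.trans len (≡.cong (l₀ ∸_) (≡.sym (ℕₚ.+-suc a m)))))))
    where
    entry : ℕ → ℕ → List ℕ → ℕ → Bool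
    entry m₀ m lo j = if (m₀ ≤ᵇ m ℕ.+ j) ∧ (m ℕ.+ j <ᵇ l₀) then lookupD up (m ℕ.+ j ∸ m₀) <ᵇ lookupD lo j else true
  colPair≡colOK zero    m l₀ []       (x ∷ lo) len =
    and-upTo-true (length (x ∷ lo)) (λ j → if-false (≤ᵇ∧<ᵇ-empty m l₀ (m ℕ.+ j) (ℕₚ.m∸n≡0⇒m≤n (≡.sym len))))
  colPair≡colOK zero    m l₀ (u ∷ up) (x ∷ lo) len = ≡.trans
    (and-upTo-suc (length lo) (λ j → if (m ≤ᵇ m ℕ.+ j) ∧ (m ℕ.+ j <ᵇ l₀)
      then lookupD (u ∷ up) (m ℕ.+ j ∸ m) <ᵇ lookupD (x ∷ lo) j else true))
    (≡.cong₂ _∧_ first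
      (≡.trans (and-upTo-cong (length lo) rest)
        (colPair≡colOK zero (suc m) l₀ up lo (≡.trans (≡.cong pred len) (ℕₚ.pred[m∸n]≡m∸[1+n] l₀ m)))))
    where
    m<l₀ : m ℕ.< l₀
    m<l₀ = ℕₚ.m∸n≢0⇒n<m (λ z → contradiction (≡.trans len z) λ ())
    first : (if (m ≤ᵇ m ℕ.+ 0) ∧ (m ℕ.+ 0 <ᵇ l₀) then lookupD (u ∷ up) (m ℕ.+ 0 ∸ m) <ᵇ x else true) ≡ (u <ᵇ x)
    first rewrite ℕₚ.+-identityʳ m | ≤⇒≤ᵇ≡true (ℕₚ.≤-refl {m}) | <⇒<ᵇ≡true m<l₀ | ℕₚ.n∸n≡0 m = ≡.refl
    rest : ∀ j → (if (m ≤ᵇ m ℕ.+ suc j) ∧ (m ℕ.+ suc j <ᵇ l₀)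
                  then lookupD (u ∷ up) (m ℕ.+ suc j ∸ m) <ᵇ lookupD lo j else true)
               ≡ (if (suc m ≤ᵇ suc m ℕ.+ j) ∧ (suc m ℕ.+ j <ᵇ l₀)
                  then lookupD up (suc m ℕ.+ j ∸ suc m) <ᵇ lookupD lo j else true)
    rest j rewrite ≤⇒≤ᵇ≡true (ℕₚ.m≤m+n m (suc j)) | ≤⇒≤ᵇ≡true (ℕₚ.m≤m+n (suc m) j)
                 | ℕₚ.m+n∸m≡n m (suc j) | ℕₚ.m+n∸m≡n m j | ℕₚ.+-suc m j = ≡.refl

  rowWeak-suc : ∀ row → rowWeak (map suc row) ≡ rowWeak row
  rowWeak-suc []            = ≡.refl
  rowWeak-suc (x ∷ [])      = ≡.refl
  rowWeak-suc (x ∷ y ∷ row) = ≡.cong₂ _∧_ (<ᵇ-suc x y) (rowWeak-suc (y ∷ row))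

  colOK-suc : ∀ a up lo → colOK a (map suc up) (map suc lo) ≡ colOK a up lo
  colOK-suc zero    []       lo       = ≡.refl
  colOK-suc zero    (u ∷ up) []       = ≡.refl
  colOK-suc zero    (u ∷ up) (x ∷ lo) = ≡.cong ((u <ᵇ x) ∧_) (colOK-suc zero up lo)
  colOK-suc (suc a) up       []       = ≡.refl
  colOK-suc (suc a) up       (x ∷ lo) = colOK-suc a up lo

  ΣL-allLists : ∀ N r (f : List ℕ → Carrier) → ΣL (allLists N r) f ≈ rows N r (λ row → f (map suc row))
  ΣL-allLists N zero    f = +-identityʳ _
  ΣL-allLists N (suc r) f = begin
    ΣL (concatMap (λ x → map (x ∷_) (allLists N r)) (map suc (upTo N))) f
      ≈⟨ ΣL-concatMap (map suc (upTo N)) (λ x → map (x ∷_) (allLists N r)) {f} ⟩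
    ΣL (map suc (upTo N)) (λ x → ΣL (map (x ∷_) (allLists N r)) f)
      ≈⟨ ΣL-map (upTo N) suc {λ x → ΣL (map (x ∷_) (allLists N r)) f} ⟩
    ΣL (upTo N) (λ x → ΣL (map (suc x ∷_) (allLists N r)) f)
      ≈⟨ ΣL-cong (upTo N) (λ x → trans (ΣL-map (allLists N r) (suc x ∷_) {f})
                                    (ΣL-allLists N r (λ row → f (suc x ∷ row)))) ⟩
    ΣL (upTo N) (λ x → rows N r (λ row → f (suc x ∷ map suc row))) ∎

  padTo : ℕ → List ℕ → List ℕ
  padTo zero    xs = []
  padTo (suc K) xs = hd xs ∷ padTo K (tl xs)

  length-tl : ∀ {K} xs → length xs ℕ.≤ suc K → length (tl xs) ℕ.≤ K
  length-tl []       p       = z≤n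
  length-tl (x ∷ xs) (s≤s p) = p

  Linked-tl : ∀ {p} xs → Linked ℕ._≥_ (p ∷ xs) → Linked ℕ._≥_ (hd xs ∷ tl xs)
  Linked-tl []       _        = [-]
  Linked-tl (x ∷ xs) (_ ∷ lk) = lk

  hd≤ : ∀ {p} xs → Linked ℕ._≥_ (p ∷ xs) → hd xs ℕ.≤ p
  hd≤ []       _       = z≤n
  hd≤ (x ∷ xs) (q ∷ _) = q

  module _ (N : ℕ) where

    fill : ℕ → ℕ → List ℕ → List ℕ → List ℕ → (List ℕ → Carrier) → List (List ℕ) → Carrier
    fill l₀ m₀ up la mu φ T = ind (all rowWeak T) * (ind (colRows l₀ m₀ (map suc up) la mu T) * φ (concat T))

    -- The global containment test is distributed over the rows, because `tableaux` tests each row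
    -- separately. Fillings have rows only for the entries of `la`; beyond them the padded rows are
    -- empty and contribute just the test that the part of `mu` is 0. Letters 1, ..., N become 0,
    -- ..., N - 1.
    fillings≈tableaux : ∀ K la mu l₀ m₀ up (φ : List ℕ → Carrier) →
      length la ℕ.≤ K → length mu ℕ.≤ K → Linked ℕ._≥_ (m₀ ∷ mu) → length up ≡ l₀ ∸ m₀ →
      ind (containedᵇ la mu) * ΣL (fillings N (rowLengths la mu)) (fill l₀ m₀ up la mu φ) ≈
      tableaux N l₀ m₀ up (padTo K la) (padTo K mu) (λ w → φ (map suc w))
    fillings≈tableaux zero    [] [] l₀ m₀ up φ pl pm lk len =
      trans (*-identityˡ _) (trans (+-identityʳ _) (trans (*-identityˡ _) (*-identityˡ _)))
    fillings≈tableaux (suc K) [] mu l₀ m₀ up φ pl pm lk len = begin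
      ind (containedᵇ [] mu) * (1# * (1# * φ []) + 0#)
        ≈⟨ *-congʳ (trans (reflexive (≡.cong ind (containedᵇ-step [] mu))) (ind-∧ (m ≤ᵇ 0) _)) ⟩
      (ind (m ≤ᵇ 0) * ind (containedᵇ [] (tl mu))) * (1# * (1# * φ []) + 0#)
        ≈⟨ *-assoc _ _ _ ⟩
      ind (m ≤ᵇ 0) * (ind (containedᵇ [] (tl mu)) * (1# * (1# * φ []) + 0#))
        ≈⟨ *-congˡ (fillings≈tableaux K [] (tl mu) 0 m [] φ z≤n (length-tl mu pm) (Linked-tl mu lk)
                      (≡.sym (ℕₚ.0∸n≡0 m))) ⟩
      ind (m ≤ᵇ 0) * tableaux N 0 m [] (padTo K []) (padTo K (tl mu)) (λ w → φ (map suc w))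
        ≈⟨ *-congˡ (sym (trans (*-identityˡ _)
             (trans (*-congʳ (reflexive (≡.cong ind (colOK-[] (m₀ ∸ m) up)))) (*-identityˡ _)))) ⟩
      ind (m ≤ᵇ 0) * weakRows N 0 F
        ≈⟨ *-congˡ (reflexive (≡.cong (λ z → weakRows N z F) (≡.sym (ℕₚ.0∸n≡0 m)))) ⟩
      ind (m ≤ᵇ 0) * weakRows N (0 ∸ m) F ∎
      where
      m = hd mu
      F : List ℕ → Carrier
      F row = ind (colOK (m₀ ∸ m) up row) *
              tableaux N 0 m row (padTo K []) (padTo K (tl mu)) (λ w → φ (map suc (row ++ w)))
    fillings≈tableaux (suc K) (x ∷ la) mu l₀ m₀ up φ pl pm lk len = begin
      ind (containedᵇ (x ∷ la) mu) * ΣL (fillings N (rowLengths (x ∷ la) mu)) f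
        ≈⟨ *-cong (trans (reflexive (≡.cong ind (containedᵇ-step (x ∷ la) mu))) (ind-∧ (m ≤ᵇ x) _))
             (reflexive (≡.cong (λ z → ΣL (fillings N z) f) (rowLengths-∷ x la mu))) ⟩
      (ind (m ≤ᵇ x) * C′) * ΣL (fillings N ((x ∸ m) ∷ rl)) f
        ≈⟨ *-assoc _ _ _ ⟩
      ind (m ≤ᵇ x) * (C′ * ΣL (fillings N ((x ∸ m) ∷ rl)) f)
        ≈⟨ *-congˡ (*-congˡ (trans (ΣL-concatMap (allLists N (x ∸ m)) (λ row → map (row ∷_) (fillings N rl)) {f})
             (trans (ΣL-cong (allLists N (x ∸ m)) (λ row → ΣL-map (fillings N rl) (row ∷_) {f}))
               (ΣL-allLists N (x ∸ m) (λ row → ΣL (fillings N rl) (λ T → f (row ∷ T))))))) ⟩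
      ind (m ≤ᵇ x) * (C′ * rows N (x ∸ m) (λ row → ΣL (fillings N rl) (λ T → f (map suc row ∷ T))))
        ≈⟨ *-congˡ (sym (lin-scale (lin-rows N (x ∸ m)) C′ (λ row → ΣL (fillings N rl) (λ T → f (map suc row ∷ T))))) ⟩
      ind (m ≤ᵇ x) * rows N (x ∸ m) (λ row → C′ * ΣL (fillings N rl) (λ T → f (map suc row ∷ T)))
        ≈⟨ *-congˡ (rows-cong N (x ∸ m) step) ⟩
      ind (m ≤ᵇ x) * weakRows N (x ∸ m) (λ row → ind (colOK (m₀ ∸ m) up row) *
        tableaux N x m row (padTo K la) (padTo K (tl mu)) (λ w → φ (map suc (row ++ w)))) ∎
      where
      m = hd mu
      f = fill l₀ m₀ up (x ∷ la) mu φ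
      C′ = ind (containedᵇ la (tl mu))
      rl = rowLengths la (tl mu)
      m≤m₀ = hd≤ mu lk

      colPair≡ : ∀ row → colPair m₀ l₀ m (map suc up) (map suc row) ≡ colOK (m₀ ∸ m) up row
      colPair≡ row = ≡.trans (≡.cong (λ z → colPair z l₀ m (map suc up) (map suc row)) (≡.sym (ℕₚ.m∸n+n≡m m≤m₀)))
        (≡.trans (colPair≡colOK (m₀ ∸ m) m l₀ (map suc up) (map suc row)
          (≡.trans (length-map suc up) (≡.trans len (≡.cong (l₀ ∸_) (≡.sym (ℕₚ.m∸n+n≡m m≤m₀))))))
          (colOK-suc (m₀ ∸ m) up row))

      step : ∀ row → length row ≡ x ∸ m → C′ * ΣL (fillings N rl) (λ T → f (map suc row ∷ T)) ≈
        ind (rowWeak row) * (ind (colOK (m₀ ∸ m) up row) *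
          tableaux N x m row (padTo K la) (padTo K (tl mu)) (λ w → φ (map suc (row ++ w))))
      step row lr = begin
        C′ * ΣL (fillings N rl) (λ T → f (map suc row ∷ T))
          ≈⟨ *-congˡ (ΣL-cong (fillings N rl) factor) ⟩
        C′ * ΣL (fillings N rl) (λ T → (A * B) * g T)
          ≈⟨ *-congˡ (ΣL-* (fillings N rl) (A * B)) ⟩
        C′ * ((A * B) * ΣL (fillings N rl) g)
          ≈⟨ solve 4 (λ c a b s → c :* ((a :* b) :* s) := a :* (b :* (c :* s))) refl C′ A B (ΣL (fillings N rl) g) ⟩
        A * (B * (C′ * ΣL (fillings N rl) g))
          ≈⟨ *-congˡ (*-congˡ (fillings≈tableaux K la (tl mu) x m row (λ w → φ (map suc row ++ w))
               (ℕₚ.≤-pred pl) (length-tl mu pm) (Linked-tl mu lk) lr)) ⟩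
        A * (B * tableaux N x m row (padTo K la) (padTo K (tl mu)) (λ w → φ (map suc row ++ map suc w)))
          ≈⟨ *-congˡ (*-congˡ (lin-cong (lin-tableaux N x m row (padTo K la) (padTo K (tl mu)))
               (λ w → reflexive (≡.cong φ (≡.sym (map-++ suc row w)))))) ⟩
        A * (B * tableaux N x m row (padTo K la) (padTo K (tl mu)) (λ w → φ (map suc (row ++ w)))) ∎
        where
        A = ind (rowWeak row)
        B = ind (colOK (m₀ ∸ m) up row)
        g = fill x m row la (tl mu) (λ w → φ (map suc row ++ w))
        factor : ∀ T → f (map suc row ∷ T) ≈ (A * B) * g T
        factor T = begin
          ind (rowWeak (map suc row) ∧ all rowWeak T) *
            (ind (colPair m₀ l₀ m (map suc up) (map suc row) ∧ col) * φ (map suc row ++ concat T))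
            ≈⟨ *-cong (trans (ind-∧ (rowWeak (map suc row)) _) (*-congʳ (reflexive (≡.cong ind (rowWeak-suc row)))))
                 (*-congʳ (trans (ind-∧ (colPair m₀ l₀ m (map suc up) (map suc row)) _)
                             (*-congʳ (reflexive (≡.cong ind (colPair≡ row)))))) ⟩
          (A * ind (all rowWeak T)) * ((B * ind col) * φ (map suc row ++ concat T))
            ≈⟨ solve 5 (λ a w b s p → (a :* w) :* ((b :* s) :* p) := (a :* b) :* (w :* (s :* p))) refl
                 A (ind (all rowWeak T)) B (ind col) _ ⟩
          (A * B) * g T ∎
          where col = colRows x m (map suc row) la (tl mu) T

  natR-filter : ∀ {A : Set} (p : A → Bool) xs → natR (length (filter (λ x → T? (p x)) xs)) ≈ ΣL xs (λ x → ind (p x))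
  natR-filter p []       = refl
  natR-filter p (x ∷ xs) with p x
  ... | true  = +-congˡ (natR-filter p xs)
  ... | false = trans (natR-filter p xs) (sym (+-identityˡ _))

  countOcc-∷ : ∀ v x w → countOcc v (x ∷ w) ≡ (if x ≡ᵇ v then suc (countOcc v w) else countOcc v w)
  countOcc-∷ v x w with x ≡ᵇ v
  ... | true  = ≡.refl
  ... | false = ≡.refl

  countOcc-suc : ∀ j w → countOcc (suc j) (map suc w) ≡ countOcc j w
  countOcc-suc j []      = ≡.refl
  countOcc-suc j (x ∷ w) = ≡.trans (countOcc-∷ (suc j) (suc x) (map suc w))
    (≡.trans (≡.cong (λ z → if x ≡ᵇ j then suc z else z) (countOcc-suc j w)) (≡.sym (countOcc-∷ j x w)))

  countOcc-0 : ∀ w → countOcc 0 w ≡ zeros w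
  countOcc-0 []          = ≡.refl
  countOcc-0 (zero ∷ w)  = ≡.cong suc (countOcc-0 w)
  countOcc-0 (suc x ∷ w) = countOcc-0 w

  countOcc-lower : ∀ j w → countOcc (suc j) w ≡ countOcc j (lower w)
  countOcc-lower j []          = ≡.refl
  countOcc-lower j (zero ∷ w)  = countOcc-lower j w
  countOcc-lower j (suc x ∷ w) = ≡.trans (countOcc-∷ (suc j) (suc x) w)
    (≡.trans (≡.cong (λ z → if x ≡ᵇ j then suc z else z) (countOcc-lower j w)) (≡.sym (countOcc-∷ j x (lower w))))

  content≈ : ∀ α w → ind (and (map (λ j → countOcc j w ≡ᵇ lookupD α j) (upTo (length α)))) ≈ content α w
  content≈ []      w = refl
  content≈ (k ∷ α) w = begin
    ind (and (map (λ j → countOcc j w ≡ᵇ lookupD (k ∷ α) j) (upTo (suc (length α)))))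
      ≈⟨ reflexive (≡.cong ind (≡.trans (and-upTo-suc (length α) (λ j → countOcc j w ≡ᵇ lookupD (k ∷ α) j))
           (≡.cong₂ _∧_ (≡.cong (_≡ᵇ k) (countOcc-0 w))
             (and-upTo-cong (length α) (λ j → ≡.cong (_≡ᵇ lookupD α j) (countOcc-lower j w)))))) ⟩
    ind ((zeros w ≡ᵇ k) ∧ and (map (λ j → countOcc j (lower w) ≡ᵇ lookupD α j) (upTo (length α))))
      ≈⟨ trans (ind-∧ (zeros w ≡ᵇ k) _) (*-congˡ (content≈ α (lower w))) ⟩
    content (k ∷ α) w ∎

  skewSchur≈tableaux : ∀ B K la mu α → length la ℕ.≤ K → length mu ℕ.≤ K → Linked ℕ._≥_ (B ∷ mu) →
    skewSchur la mu α ≈ tableaux (length α) B B [] (padTo K la) (padTo K mu) (content α)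
  skewSchur≈tableaux B K la mu α pl pm lk = begin
    skewSchur la mu α
      ≈⟨ if-ind (containedᵇ la mu) _ ⟩
    ind (containedᵇ la mu) * natR (numSSYT la mu α)
      ≈⟨ *-congˡ (natR-filter (isSSYT la mu α) (fillings N (rowLengths la mu))) ⟩
    ind (containedᵇ la mu) * ΣL (fillings N (rowLengths la mu)) (λ T → ind (isSSYT la mu α T))
      ≈⟨ *-congˡ (ΣL-cong (fillings N (rowLengths la mu)) (λ T →
           trans (ind-∧ (all rowWeak T) _) (*-congˡ (trans (ind-∧ (colStrict la mu 0 T) _)
             (*-congʳ (reflexive (≡.cong ind (colStrict≡colRows B la mu T)))))))) ⟩
    ind (containedᵇ la mu) * ΣL (fillings N (rowLengths la mu)) (fill N B B [] la mu φ)
      ≈⟨ fillings≈tableaux N K la mu B B [] φ pl pm lk (≡.sym (ℕₚ.n∸n≡0 B)) ⟩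
    tableaux N B B [] (padTo K la) (padTo K mu) (λ w → φ (map suc w))
      ≈⟨ lin-cong (lin-tableaux N B B [] (padTo K la) (padTo K mu)) (λ w →
           trans (reflexive (≡.cong ind (and-upTo-cong (length α) (λ j → ≡.cong (_≡ᵇ lookupD α j) (countOcc-suc j w)))))
                 (content≈ α w)) ⟩
    tableaux N B B [] (padTo K la) (padTo K mu) (content α) ∎
    where
    N = length α
    φ : List ℕ → Carrier
    φ w = ind (and (map (λ j → countOcc (suc j) w ≡ᵇ lookupD α j) (upTo N)))
    if-ind : ∀ b z → (if b then z else 0#) ≈ ind b * z
    if-ind true  z = sym (*-identityˡ z)
    if-ind false z = sym (zeroˡ z)

  -- Adding and removing boxes

  padTo-Linked : ∀ K {p} xs → Linked ℕ._≥_ (p ∷ xs) → Linked ℕ._≥_ (p ∷ padTo K xs)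
  padTo-Linked zero    xs lk = [-]
  padTo-Linked (suc K) xs lk = hd≤ xs lk ∷ padTo-Linked K (tl xs) (Linked-tl xs lk)

  unpad-Linked : ∀ K xs → length xs ℕ.≤ K → Linked ℕ._≥_ (padTo K xs) → Linked ℕ._≥_ xs
  unpad-Linked K             []           p             lk       = []
  unpad-Linked K             (x ∷ [])     p             lk       = [-]
  unpad-Linked (suc (suc K)) (x ∷ y ∷ xs) (s≤s p)       (q ∷ lk) = q ∷ unpad-Linked (suc K) (y ∷ xs) p lk

  length-padTo : ∀ K xs → length (padTo K xs) ≡ K
  length-padTo zero    xs = ≡.refl
  length-padTo (suc K) xs = ≡.cong suc (length-padTo K (tl xs))

  lookupD-padTo : ∀ K xs k → k ℕ.< K → lookupD (padTo K xs) k ≡ lookupD xs k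
  lookupD-padTo (suc K) xs zero    p       = ≡.refl
  lookupD-padTo (suc K) xs (suc k) (s≤s p) = ≡.trans (lookupD-padTo K (tl xs) k p) (≡.sym (lookupD-tl xs k))

  ∷-Linked : ∀ {p} xs → hd xs ℕ.≤ p → Linked ℕ._≥_ xs → Linked ℕ._≥_ (p ∷ xs)
  ∷-Linked []       _ _  = [-]
  ∷-Linked (x ∷ xs) q lk = q ∷ lk

  -- The Jacobi-Trudi identity, including the case where `mu` is not contained in `la` and both
  -- sides are zero.
  skewSchur≈J : ∀ K la mu → length la ℕ.≤ K → length mu ℕ.≤ K → IsPartition la → IsPartition mu →
    skewSchur la mu ≋ J (shift (padTo K la)) (shift (padTo K mu))
  skewSchur≈J K la mu pl pm lkl lkm α = trans
    (skewSchur≈tableaux B K la mu α pl pm lkm′)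
    (tableaux≈J B α (padTo K la) (padTo K mu) (≡.trans (length-padTo K la) (≡.sym (length-padTo K mu)))
      (padTo-Linked K la (∷-Linked la (ℕₚ.m≤m+n (hd la) (hd mu)) lkl)) (padTo-Linked K mu lkm′))
    where
    -- A common upper bound for both first parts, serving as the column of the fictitious empty row
    -- on top.
    B = hd la ℕ.+ hd mu
    lkm′ = ∷-Linked mu (ℕₚ.m≤n+m (hd mu) (hd la)) lkm

  ∧-true₁ : ∀ b {b′} → (b ∧ b′) ≡ true → b ≡ true
  ∧-true₁ true _ = ≡.refl

  ∧-true₂ : ∀ b {b′} → (b ∧ b′) ≡ true → b′ ≡ true
  ∧-true₂ true e = e

  isPartitionᵇ-sound : ∀ xs → isPartitionᵇ xs ≡ true → IsPartition xs
  isPartitionᵇ-sound []           e = []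
  isPartitionᵇ-sound (x ∷ [])     e = [-]
  isPartitionᵇ-sound (x ∷ y ∷ xs) e =
    ≤ᵇ≡true⇒≤ y x (∧-true₁ _ e) ∷ isPartitionᵇ-sound (y ∷ xs) (∧-true₂ (y ≤ᵇ x) e)

  isPartitionᵇ-complete : ∀ {xs} → IsPartition xs → isPartitionᵇ xs ≡ true
  isPartitionᵇ-complete []       = ≡.refl
  isPartitionᵇ-complete [-]      = ≡.refl
  isPartitionᵇ-complete (p ∷ lk) = ≡.cong₂ _∧_ (≤⇒≤ᵇ≡true p) (isPartitionᵇ-complete lk)

  padTo-decAt : ∀ K xs k → padTo K (decAt xs k) ≡ decAt (padTo K xs) k
  padTo-decAt zero    xs       k       = ≡.refl
  padTo-decAt (suc K) []       zero    = ≡.refl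
  padTo-decAt (suc K) (x ∷ xs) zero    = ≡.refl
  padTo-decAt (suc K) []       (suc k) = ≡.cong (0 ∷_) (padTo-decAt K [] k)
  padTo-decAt (suc K) (x ∷ xs) (suc k) = ≡.cong (x ∷_) (padTo-decAt K xs k)

  length-decAt : ∀ xs k → length (decAt xs k) ≡ length xs
  length-decAt []       k       = ≡.refl
  length-decAt (x ∷ xs) zero    = ≡.refl
  length-decAt (x ∷ xs) (suc k) = ≡.cong suc (length-decAt xs k)

  -- For a zero part the two would differ: `pred` fixes 0 but still lowers the positive shifted
  -- entry.
  shift-decAt : ∀ xs k → 1 ℕ.≤ lookupD xs k → shift (decAt xs k) ≡ decAt (shift xs) k
  shift-decAt (suc x ∷ xs) zero    p = ≡.refl
  shift-decAt (x ∷ xs)     (suc k) p = ≡.cong₂ (λ n ys → x ℕ.+ suc n ∷ ys) (length-decAt xs k) (shift-decAt xs k p)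

  padTo-incAt : ∀ K xs k → k ℕ.< K → padTo K (incAt xs k) ≡ incAt (padTo K xs) k
  padTo-incAt (suc K) []       zero    p       = ≡.refl
  padTo-incAt (suc K) (x ∷ xs) zero    p       = ≡.refl
  padTo-incAt (suc K) []       (suc k) (s≤s p) = ≡.cong (0 ∷_) (padTo-incAt K [] k p)
  padTo-incAt (suc K) (x ∷ xs) (suc k) (s≤s p) = ≡.cong (x ∷_) (padTo-incAt K xs k p)

  length-incAt : ∀ {K} xs k → length xs ℕ.≤ K → k ℕ.< K → length (incAt xs k) ℕ.≤ K
  length-incAt []       zero    p       q       = q
  length-incAt []       (suc k) p       (s≤s q) = s≤s (length-incAt [] k z≤n q)
  length-incAt (x ∷ xs) zero    p       q       = p
  length-incAt (x ∷ xs) (suc k) (s≤s p) (s≤s q) = s≤s (length-incAt xs k p q)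

  length-incAt-< : ∀ xs k → k ℕ.< length xs → length (incAt xs k) ≡ length xs
  length-incAt-< (x ∷ xs) zero    p       = ≡.refl
  length-incAt-< (x ∷ xs) (suc k) (s≤s p) = ≡.cong suc (length-incAt-< xs k p)

  shift-incAt : ∀ xs k → k ℕ.< length xs → shift (incAt xs k) ≡ incAt (shift xs) k
  shift-incAt (x ∷ xs) zero    p       = ≡.refl
  shift-incAt (x ∷ xs) (suc k) (s≤s p) =
    ≡.cong₂ (λ n ys → x ℕ.+ suc n ∷ ys) (length-incAt-< xs k p) (shift-incAt xs k p)

  lookupD-shift : ∀ xs k → k ℕ.< length xs → lookupD (shift xs) k ℕ.+ suc k ≡ lookupD xs k ℕ.+ suc (length xs)
  lookupD-shift (x ∷ xs) zero    p       = ≡.trans (ℕₚ.+-assoc x _ 1)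
    (≡.cong (λ z → x ℕ.+ suc z) (ℕₚ.+-comm (length xs) 1))
  lookupD-shift (x ∷ xs) (suc k) (s≤s p) = ≡.trans (ℕₚ.+-suc _ (suc k))
    (≡.trans (≡.cong suc (lookupD-shift xs k p)) (≡.sym (ℕₚ.+-suc _ (suc (length xs)))))

  decAt-≥ : ∀ {xs} k → Linked ℕ._>_ xs → Linked ℕ._≥_ (decAt xs k)
  decAt-≥ k             []       = []
  decAt-≥ zero          [-]      = [-]
  decAt-≥ (suc k)       [-]      = [-]
  decAt-≥ zero          (p ∷ lk) = ℕₚ.<⇒≤pred p ∷ >⇒≥ lk
  decAt-≥ (suc zero)    (_∷_ {x} {y} p lk) = cons (decAt-≥ zero lk)
    where
    cons : ∀ {ys} → Linked ℕ._≥_ (pred y ∷ ys) → Linked ℕ._≥_ (x ∷ pred y ∷ ys)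
    cons lk = ℕₚ.≤-trans (ℕₚ.pred[n]≤n {y}) (ℕₚ.<⇒≤ p) ∷ lk
  decAt-≥ (suc (suc k)) (p ∷ lk) = ℕₚ.<⇒≤ p ∷ decAt-≥ (suc k) lk

  -- Used contrapositively to feed `J-vanish`. In the last row the part is at least 1 by positivity
  -- of the lowered entry; in any other row because strictness forces it to exceed the next part.
  decAt-strict : ∀ xs k → k ℕ.< length xs → Linked ℕ._≥_ xs → Linked ℕ._>_ (decAt (shift xs) k) →
    All (0 ℕ.<_) (decAt (shift xs) k) → 1 ℕ.≤ lookupD xs k × Linked ℕ._≥_ (decAt xs k)
  decAt-strict (x ∷ [])     zero    p lk lk′ (pos ∷ _) =
    ≡.subst (λ z → 0 ℕ.< pred z) (ℕₚ.+-comm x 1) pos , [-]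
  decAt-strict (x ∷ y ∷ xs) zero    p (_ ∷ lk) (q ∷ _) _ = ℕₚ.≤-<-trans z≤n y<x , ℕₚ.<⇒≤pred y<x ∷ lk
    where
    y<x : y ℕ.< x
    y<x = ℕₚ.+-cancelʳ-< (suc (length xs)) y x (≡.subst (λ z → y ℕ.+ suc (length xs) ℕ.< pred z) (ℕₚ.+-suc x _) q)
  decAt-strict (x ∷ [])     (suc k) (s≤s ()) lk lk′ pos
  decAt-strict (x ∷ y ∷ xs) (suc k) (s≤s p) (q ∷ lk) lk′ (_ ∷ pos)
    with decAt-strict (y ∷ xs) k p lk (Linked.tail lk′) pos
  ... | r , lk″ = r , cons k lk″
    where
    cons : ∀ k → Linked ℕ._≥_ (decAt (y ∷ xs) k) → Linked ℕ._≥_ (x ∷ decAt (y ∷ xs) k)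
    cons zero    lk = ℕₚ.≤-trans (ℕₚ.pred[n]≤n {y}) q ∷ lk
    cons (suc k) lk = q ∷ lk

  -- Adding a box fails only below an equal part; the two shifted entries then differ by one, and
  -- the increment makes two columns coincide.
  incAt-partition : ∀ xs k → k ℕ.< length xs → Linked ℕ._≥_ xs →
    Linked ℕ._≥_ (incAt xs k) ⊎ AdjEqual (incAt (shift xs) k)
  incAt-partition (x ∷ [])     zero          p lk       = inj₁ [-]
  incAt-partition (x ∷ y ∷ xs) zero          p (q ∷ lk) = inj₁ (ℕₚ.m≤n⇒m≤1+n q ∷ lk)
  incAt-partition (x ∷ [])     (suc k)       (s≤s ()) lk
  incAt-partition (x ∷ y ∷ xs) (suc zero)    (s≤s p) (q ∷ lk) with ℕₚ.m≤n⇒m<n∨m≡n q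
  ... | inj₂ ≡.refl = inj₂ (≡.subst
      (λ z → AdjEqual (z ∷ suc (x ℕ.+ suc (length xs)) ∷ shift xs)) (≡.sym (ℕₚ.+-suc x _)) here)
  ... | inj₁ y<x with incAt-partition (y ∷ xs) zero p lk
  ...   | inj₁ lk′ = inj₁ (y<x ∷ lk′)
  ...   | inj₂ e   = inj₂ (there e)
  incAt-partition (x ∷ y ∷ xs) (suc (suc k)) (s≤s p) (q ∷ lk) with incAt-partition (y ∷ xs) (suc k) p lk
  ... | inj₁ lk′ = inj₁ (q ∷ lk′)
  ... | inj₂ e   = inj₂ (there e)

  -- Comparing the sums over rows and columns with the right-hand side

  bump-pred : ∀ w xs (Φ : List ℕ → Carrier) →
    bump pred w Φ xs ≈ ΣL (upTo (length xs)) (λ k → w (lookupD xs k) * Φ (decAt xs k))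
  bump-pred w []       Φ = refl
  bump-pred w (x ∷ xs) Φ = trans (+-congˡ (bump-pred w xs (λ ys → Φ (x ∷ ys))))
    (sym (ΣL-upTo-suc (length xs) (λ k → w (lookupD (x ∷ xs) k) * Φ (decAt (x ∷ xs) k))))

  bump-suc : ∀ w xs (Φ : List ℕ → Carrier) →
    bump suc w Φ xs ≈ ΣL (upTo (length xs)) (λ k → w (lookupD xs k) * Φ (incAt xs k))
  bump-suc w []       Φ = refl
  bump-suc w (x ∷ xs) Φ = trans (+-congˡ (bump-suc w xs (λ ys → Φ (x ∷ ys))))
    (sym (ΣL-upTo-suc (length xs) (λ k → w (lookupD (x ∷ xs) k) * Φ (incAt (x ∷ xs) k))))

  ΣL-upTo-cong : ∀ n {f g : ℕ → Carrier} → (∀ k → k ℕ.< n → f k ≈ g k) → ΣL (upTo n) f ≈ ΣL (upTo n) g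
  ΣL-upTo-cong zero    e = refl
  ΣL-upTo-cong (suc n) {f} {g} e = trans (ΣL-upTo-suc n f)
    (trans (+-cong (e 0 (s≤s z≤n)) (ΣL-upTo-cong n (λ k p → e (suc k) (s≤s p)))) (sym (ΣL-upTo-suc n g)))

  sumS-at : ∀ (xs : List ℕ) (F : ℕ → Series) α → sumS (map F xs) α ≡ ΣL xs (λ k → F k α)
  sumS-at []       F α = ≡.refl
  sumS-at (x ∷ xs) F α = ≡.cong (F x α +_) (sumS-at xs F α)

  natR-diff : ∀ {x y x′ y′} → x ℕ.+ y′ ≡ x′ ℕ.+ y → natR x + - natR y ≈ natR x′ + - natR y′
  natR-diff {x} {y} {x′} {y′} e = begin
    natR x + - natR y                                ≈⟨ +-identityʳ _ ⟨
    (natR x + - natR y) + 0#                         ≈⟨ +-congˡ (-‿inverseʳ (natR y′)) ⟨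
    (natR x + - natR y) + (natR y′ + - natR y′)      ≈⟨ regroup (natR x) (- natR y) (natR y′) (- natR y′) ⟩
    (natR x + natR y′) + (- natR y + - natR y′)      ≈⟨ +-congʳ (trans (sym (natR-+ x y′))
                                                         (trans (reflexive (≡.cong natR e)) (natR-+ x′ y))) ⟩
    (natR x′ + natR y) + (- natR y + - natR y′)      ≈⟨ solve 4 (λ a b c d →
                                                         (a :+ b) :+ (c :+ d) := (a :+ d) :+ (b :+ c)) refl
                                                         (natR x′) (natR y) (- natR y) (- natR y′) ⟩
    (natR x′ + - natR y′) + (natR y + - natR y)      ≈⟨ trans (+-congˡ (-‿inverseʳ (natR y))) (+-identityʳ _) ⟩
    natR x′ + - natR y′ ∎
    where
    regroup : ∀ a b c d → (a + b) + (c + d) ≈ (a + c) + (b + d)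
    regroup = solve 4 (λ a b c d → (a :+ b) :+ (c :+ d) := (a :+ c) :+ (b :+ d)) refl

  module _ {q a b : Carrier} (ab : a + b ≈ q + - 1#) {la mu : List ℕ} (lkl : IsPartition la) (lkm : IsPartition mu)
           {D : Series → Series} (nabla : IsNabla q D) where
    private
      K = suc (length la ℕ.+ length mu)
      pl : length la ℕ.≤ K
      pl = ℕₚ.m≤n⇒m≤1+n (ℕₚ.m≤m+n (length la) (length mu))
      pm : length mu ℕ.≤ K
      pm = ℕₚ.m≤n⇒m≤1+n (ℕₚ.m≤n+m (length mu) (length la))
      la⁺ = padTo K la
      mu⁺ = padTo K mu
      lkl⁺ : Linked ℕ._≥_ la⁺
      lkl⁺ = Linked.tail (padTo-Linked K la (∷-Linked la ℕₚ.≤-refl lkl))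
      lkm⁺ : Linked ℕ._≥_ mu⁺
      lkm⁺ = Linked.tail (padTo-Linked K mu (∷-Linked mu ℕₚ.≤-refl lkm))
      ls = shift la⁺
      ms = shift mu⁺
      -- In a list of length `K`, `shift` turns the part at position k into λᵢ + K - k with i = k +
      -- 1, that is λᵢ - i + (K + 1).
      open Nabla ab nabla (natR (suc K))

      <-length : ∀ xs {k} → k ℕ.< K → k ℕ.< length (padTo K xs)
      <-length xs {k} = ≡.subst (k ℕ.<_) (≡.sym (length-padTo K xs))

      diff : ∀ xs k → k ℕ.< K →
        natR (lookupD (shift (padTo K xs)) k) + - natR (suc K) ≈ natR (lookupD xs k) + - natR (suc k)
      diff xs k k<K = natR-diff {lookupD (shift (padTo K xs)) k} {suc K} {lookupD xs k} {suc k}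
        (≡.trans (lookupD-shift (padTo K xs) k (<-length xs k<K))
          (≡.cong₂ (λ x n → x ℕ.+ suc n) (lookupD-padTo K xs k k<K) (length-padTo K xs)))

      removal : ∀ α k → k ℕ.< K → wA (lookupD ls k) * J (decAt ls k) ms α ≈
        (if minusIsPart la k
         then ((natR (lookupD la k) + - natR (suc k)) + a) · skewSchur (decAt la k) mu
         else zeroS) α
      removal α k k<K with 1 ≤ᵇ lookupD la k in e₁ | isPartitionᵇ (decAt la k) in e₂
      ... | true | true = *-cong (+-congʳ (diff la k k<K)) (sym (trans
          (skewSchur≈J K (decAt la k) mu (≡.subst (ℕ._≤ K) (≡.sym (length-decAt la k)) pl) pm
            (isPartitionᵇ-sound _ e₂) lkm α)
          (reflexive (≡.cong (λ z → J z ms α) (≡.trans (≡.cong shift (padTo-decAt K la k)) (shift-decAt la⁺ k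
            (≡.subst (1 ℕ.≤_) (≡.sym (lookupD-padTo K la k k<K)) (≤ᵇ≡true⇒≤ 1 (lookupD la k) e₁))))))))
      -- If the lowered shifted parts were strictly decreasing and positive, λ - eᵢ would be a
      -- partition against `e₂`; the next clause contradicts `e₁` in the same way.
      ... | true | false = trans (*-congˡ (J-vanish (decAt ls k) ms α (decAt-≥ k (shift-> lkl⁺))
          (λ { (lk , pos) → contradiction (≡.trans (≡.sym e₂) (isPartitionᵇ-complete (unpad-Linked K (decAt la k)
                  (≡.subst (ℕ._≤ K) (≡.sym (length-decAt la k)) pl)
                  (≡.subst (Linked ℕ._≥_) (≡.sym (padTo-decAt K la k))
                    (proj₂ (decAt-strict la⁺ k (<-length la k<K) lkl⁺ lk pos)))))) λ () })
          (shift-> lkm⁺) (shift-pos mu⁺))) (zeroʳ _)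
      ... | false | _ = trans (*-congˡ (J-vanish (decAt ls k) ms α (decAt-≥ k (shift-> lkl⁺))
          (λ { (lk , pos) → contradiction (≡.trans (≡.sym e₁) (≤⇒≤ᵇ≡true
                  (≡.subst (1 ℕ.≤_) (lookupD-padTo K la k k<K)
                    (proj₁ (decAt-strict la⁺ k (<-length la k<K) lkl⁺ lk pos))))) λ () })
          (shift-> lkm⁺) (shift-pos mu⁺))) (zeroʳ _)

      addition : ∀ α k → k ℕ.< K → wB (lookupD ms k) * J ls (incAt ms k) α ≈
        (if plusIsPart mu k
         then (b + - (natR (lookupD mu k) + - natR (suc k))) · skewSchur la (incAt mu k)
         else zeroS) α
      addition α k k<K with isPartitionᵇ (incAt mu k) in eq
      ... | true = *-cong (+-congˡ (-‿cong (diff mu k k<K))) (sym (trans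
          (skewSchur≈J K la (incAt mu k) pl (length-incAt mu k pm k<K) lkl (isPartitionᵇ-sound _ eq) α)
          (reflexive (≡.cong (λ z → J ls z α) (≡.trans (≡.cong shift (padTo-incAt K mu k k<K))
            (shift-incAt mu⁺ k (<-length mu k<K)))))))
      ... | false with incAt-partition mu⁺ k (<-length mu k<K) lkm⁺
      ...   | inj₂ e  = trans (*-congˡ (Alternating.vanishes (J-alternating ls α) e)) (zeroʳ _)
      ...   | inj₁ lk = contradiction (≡.trans (≡.sym eq) (isPartitionᵇ-complete (unpad-Linked K (incAt mu k)
          (length-incAt mu k pm k<K) (≡.subst (Linked ℕ._≥_) (≡.sym (padTo-incAt K mu k k<K)) lk)))) λ ()

    ∇-skewSchur : D (skewSchur la mu) ≋ rhs a b la mu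
    ∇-skewSchur α = begin
      D (skewSchur la mu) α
        -- The skew Schur function inherits its membership in Λ from the determinant.
        ≈⟨ IsNabla.cong nabla (skewSchur la mu) (J ls ms) (Λ-resp (λ β → sym (s≋J β)) (Λ-J ls ms)) (Λ-J ls ms) s≋J α ⟩
      D (J ls ms) α
        ≈⟨ D-J ls ms (shift-pos la⁺) α ⟩
      bump pred wA (λ ls′ → J ls′ ms α) ls + bump suc wB (λ ns → J ls ns α) ms
        ≈⟨ +-cong (trans (bump-pred wA ls (λ ls′ → J ls′ ms α)) (reflexive (≡.cong (λ n → ΣL (upTo n) down) (length-K la))))
                  (trans (bump-suc wB ms (λ ns → J ls ns α)) (reflexive (≡.cong (λ n → ΣL (upTo n) up) (length-K mu)))) ⟩
      ΣL (upTo K) down + ΣL (upTo K) up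
        ≈⟨ +-cong (trans (ΣL-upTo-cong K (removal α)) (reflexive (≡.sym (sumS-at (upTo K) _ α))))
                  (trans (ΣL-upTo-cong K (addition α)) (reflexive (≡.sym (sumS-at (upTo K) _ α)))) ⟩
      rhs a b la mu α ∎
      where
      down up : ℕ → Carrier
      down k = wA (lookupD ls k) * J (decAt ls k) ms α
      up   k = wB (lookupD ms k) * J ls (incAt ms k) α
      s≋J : skewSchur la mu ≋ J ls ms
      s≋J = skewSchur≈J K la mu pl pm lkl lkm
      length-K : ∀ xs → length (shift (padTo K xs)) ≡ K
      length-K xs = ≡.trans (length-shift (padTo K xs)) (length-padTo K xs)

theorem3 : ∀ {c ℓ : Level} (R : CommutativeRing c ℓ) →
    let open SymFun R in
    (q a b : Carrier) → a + b ≈ q + - 1# →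
    (la mu : List ℕ) → IsPartition la → IsPartition mu →
    (D : Series → Series) → IsNabla q D →
    D (skewSchur la mu) ≋ rhs a b la mu
theorem3 R q a b ab la mu lkl lkm D nabla = Proof.∇-skewSchur R ab lkl lkm nabla
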